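{- Let $a>0$ be an integer, let $RM_a^{(1)} = \sum_{i\geq 0} (-1)^i m_{(a+i)}\, e_{i}^\perp$, and define $$RM_a = \sum_{k \geq 0} (-1)^k \frac{\left( RM_a^{(1)} \right)^{k+1} }{(k+1)!} \left(h_a^k\right)^\perp .$$ Then $RM_a\, m_\lambda = m_{\lambda+(a)}$ for every partition $\lambda$.
   Context: $m_\lambda$, $e_i$, $h_a$ are the monomial, elementary, and complete homogeneous symmetric functions ($e_0=1$), with $m_{(a+i)}$ acting by multiplication; $g^\perp$ denotes the adjoint of multiplication by $g$ with respect to the Hall inner product, and $(h_a^k)^\perp$ is the adjoint of multiplication by the $k$-th power $h_a^k$. $\lambda+(a)$ is the partition obtained by inserting a part equal to $a$ into $\lambda$. -}

module Defs where

-- Symmetric functions over ℚ, modelled as symmetric formal power series in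
-- variables x₁, x₂, … : a series is its coefficient function on exponent
-- vectors α (a list (α₁,…,αₙ) of naturals = exponents of x₁,…,xₙ, all further
-- exponents being 0).  For a symmetric series f and a partition λ, the
-- coefficient of m_λ in f is  f λ.

open import Data.Nat as ℕ using (ℕ; zero; suc; _≤ᵇ_; _∸_; _!)
open import Data.Nat.Properties using (_!≢0)
open import Data.Integer using (+_)
open import Data.Rational using (ℚ; 0ℚ; 1ℚ; _+_; _*_; -_; _/_)
open import Data.List using (List; []; _∷_; map; foldr; concatMap; upTo; zipWith; replicate; _++_)
import Data.List.Properties as LP
open import Data.Bool using (Bool; true; false; if_then_else_)
open import Data.Product using (_×_; _,_)
open import Relation.Nullary using (does)
open import Relation.Binary.PropositionalEquality using (_≡_)

data IsPartition : List ℕ → Set where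
  nil  : IsPartition []
  one  : ∀ {x} → 0 ℕ.< x → IsPartition (x ∷ [])
  cons : ∀ {x y ys} → y ℕ.≤ x → IsPartition (y ∷ ys) → IsPartition (x ∷ y ∷ ys)

insertDesc : ℕ → List ℕ → List ℕ
insertDesc x [] = x ∷ []
insertDesc x (y ∷ ys) = if y ≤ᵇ x then x ∷ y ∷ ys else y ∷ insertDesc x ys

normalize : List ℕ → List ℕ
normalize [] = []
normalize (zero ∷ xs) = normalize xs
normalize (suc x ∷ xs) = insertDesc (suc x) (normalize xs)

addPart : ℕ → List ℕ → List ℕ
addPart a λ' = normalize (a ∷ λ')

size : List ℕ → ℕ
size = foldr ℕ._+_ 0

Series : Set
Series = List ℕ → ℚ

sumℚ : List ℚ → ℚ
sumℚ = foldr _+_ 0ℚ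

_==_ : List ℕ → List ℕ → Bool
xs == ys = does (LP.≡-dec ℕ._≟_ xs ys)

below : List ℕ → List (List ℕ)
below [] = [] ∷ []
below (x ∷ xs) = concatMap (λ b → map (b ∷_) (below xs)) (upTo (suc x))

_⋆_ : Series → Series → Series
(S ⋆ T) α = sumℚ (map (λ β → S β * T (zipWith _∸_ α β)) (below α))

mS : List ℕ → Series
mS λ' α = if normalize α == λ' then 1ℚ else 0ℚ

eS : ℕ → Series
eS i = mS (replicate i 1)

hS : ℕ → Series
hS r α = if size α ℕ.≡ᵇ r then 1ℚ else 0ℚ

hProd : List ℕ → Series
hProd [] = hS 0
hProd (r ∷ λ') = hS r ⋆ hProd λ'

HPoly : Set
HPoly = List (ℚ × List ℕ)

toSeries : HPoly → Series
toSeries g α = sumℚ (map (λ { (c , μ) → c * hProd μ α }) g)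

mulH : HPoly → List ℕ → HPoly
mulH g ν = map (λ { (c , μ) → (c , μ ++ ν) }) g

-- Hall inner product ⟨f , Σ c h_μ⟩ = Σ c [m_μ] f   (from ⟨m_λ , h_μ⟩ = δ_{λμ})
hall : Series → HPoly → ℚ
hall f g = sumℚ (map (λ { (c , μ) → c * f (normalize μ) }) g)

-- g^⊥ : adjoint of multiplication by g.  Its m_ν-coefficient is
-- ⟨g^⊥ f , h_ν⟩ = ⟨f , g h_ν⟩.
perp : HPoly → Series → Series
perp g f α = hall f (mulH g (normalize α))

sgn : ℕ → ℚ
sgn zero = 1ℚ
sgn (suc i) = - sgn i

iter : ℕ → (Series → Series) → Series → Series
iter zero F f = f
iter (suc n) F f = F (iter n F f)

invFact : ℕ → ℚ
invFact n = _/_ (+ 1) (n !) {{n !≢0}}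

-- eH i is an h-expansion of e_i (supplied as a hypothesis of the theorem).
-- RM_a^{(1)} f = Σ_{i ≥ 0} (-1)^i m_(a+i) · e_i^⊥ f.  The coefficient of x^α only
-- receives contributions from i ≤ |α| (for a+i > |α| the term vanishes), so
-- the sum is truncated there (exactly).
RM1 : (ℕ → HPoly) → ℕ → Series → Series
RM1 eH a f α =
  sumℚ (map (λ i → sgn i * (mS (a ℕ.+ i ∷ []) ⋆ perp (eH i) f) α) (upTo (suc (size α))))

-- RM_a f = Σ_{k ≥ 0} (-1)^k (RM_a^{(1)})^{k+1} (h_a^k)^⊥ f / (k+1)!.
-- RM_a^{(1)} raises degree by a ≥ 1, so the coefficient of x^α only receives
-- contributions from k with a(k+1) ≤ |α|, in particular k ≤ |α|; truncated there.
RM : (ℕ → HPoly) → ℕ → Series → Series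
RM eH a f α =
  sumℚ (map (λ k → sgn k * invFact (suc k) *
                   iter (suc k) (RM1 eH a) (perp ((1ℚ , replicate k a) ∷ []) f) α)
            (upTo (suc (size α))))

module Submission where

open import Defs
open import Data.Nat as ℕ using (ℕ; zero; suc; _≤_; _<_; z≤n; s≤s; _∸_; _≡ᵇ_; _≤ᵇ_; _!)
import Data.Nat.Properties as ℕP
import Data.Integer as ℤ
import Data.Integer.Properties as ℤP
open import Data.Rational using (ℚ; 0ℚ; 1ℚ; _+_; _*_; -_; _/_)
import Data.Rational as ℚ
import Data.Rational.Properties as ℚP
import Data.Rational.Unnormalised as ℚᵘ
import Data.Rational.Unnormalised.Properties as ℚᵘP
open import Data.Rational.Solver using (module +-*-Solver)
open import Data.List using (List; []; _∷_; map; concatMap; upTo; applyUpTo; zipWith; replicate; _++_)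
import Data.List.Properties as LP
open import Data.Bool using (Bool; true; false; if_then_else_; T)
open import Data.Product using (_,_)
open import Data.Sum using (_⊎_; inj₁; inj₂)
open import Data.Empty using (⊥-elim)
open import Data.Nat.Induction using (<-rec)
open import Function using (_∘_; id; flip)
open import Relation.Nullary using (yes; no)
open import Relation.Nullary.Decidable using (dec-true; dec-false)
open import Relation.Binary.Definitions using (tri<; tri≈; tri>)
open import Relation.Binary.PropositionalEquality

open +-*-Solver using (solve; _:+_; _:*_; :-_; _:=_; con)
open ≡-Reasoning

-- Let C_a f = Σ_j x_j^a f(x with x_j = 0).  Setting x_j = 0 turns h_r into h_r − x_j h_{r−1}, so
-- C_a(h_r f) = h_r C_a f − h_{r−1} C_{a+1} f.  The operators RM_a^{(1)} satisfy the same recursion, because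
-- e_i^⊥(h_r f) = h_r e_i^⊥ f + h_{r−1} e_{i−1}^⊥ f, and both families send 1 to p_a.  Hence RM_a^{(1)} = C_a on
-- the span of the products h_τ.  By Newton's identities this span contains p_a, so it is stable under all C_a
-- with a > 0.  On monomials C_a m_λ = (mult_a(λ) + 1) m_{λ+(a)}; dividing by the multiplicity shows that every
-- m_λ lies in the span.  Since (h_a^k)^⊥ removes k parts a, with c = mult_a(λ) we get
--   RM_a m_λ = Σ_k (-1)^k C(c + 1, k + 1) m_{λ+(a)} = m_{λ+(a)}.
-- An h-expansion of e_i need not be unique as a list, but on the span the Hall pairing only sees the series it
-- represents, by the symmetry [x^α] h_τ = [x^τ] h_α.

-- Rearrangement identities in ℚ.

+-middle : ∀ a b c d → (a + b) + (c + d) ≡ (a + c) + (b + d)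
+-middle = solve 4 (λ a b c d → (a :+ b) :+ (c :+ d) := (a :+ c) :+ (b :+ d)) refl

*-swapˡ : ∀ a b c → a * (b * c) ≡ b * (a * c)
*-swapˡ = solve 3 (λ a b c → a :* (b :* c) := b :* (a :* c)) refl

+-cancel : ∀ v u → (v + u) + (- 1ℚ) * u ≡ v
+-cancel = solve 2 (λ v u → (v :+ u) :+ con (- 1ℚ) :* u := v) refl

-- Finite sums and convolutions

Σ< : ℕ → (ℕ → ℚ) → ℚ
Σ< zero F = 0ℚ
Σ< (suc n) F = F 0 + Σ< n (F ∘ suc)

-- Carrying both indices of the pairs with i + j = n keeps truncated subtraction out of the
-- convolution identities.
conv : ℕ → (ℕ → ℕ → ℚ) → ℚ
conv zero F = F 0 0
conv (suc n) F = F 0 (suc n) + conv n (F ∘ suc)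

Σ<-cong : ∀ n {F G} → (∀ i → i < n → F i ≡ G i) → Σ< n F ≡ Σ< n G
Σ<-cong zero eq = refl
Σ<-cong (suc n) eq = cong₂ _+_ (eq 0 (s≤s z≤n)) (Σ<-cong n λ i i<n → eq (suc i) (s≤s i<n))

Σ<-+ : ∀ n F G → Σ< n (λ i → F i + G i) ≡ Σ< n F + Σ< n G
Σ<-+ zero F G = refl
Σ<-+ (suc n) F G = trans (cong (F 0 + G 0 +_) (Σ<-+ n (F ∘ suc) (G ∘ suc))) (+-middle (F 0) (G 0) _ _)

Σ<-* : ∀ n c F → Σ< n (λ i → c * F i) ≡ c * Σ< n F
Σ<-* zero c F = sym (ℚP.*-zeroʳ c)
Σ<-* (suc n) c F = trans (cong (c * F 0 +_) (Σ<-* n c (F ∘ suc))) (sym (ℚP.*-distribˡ-+ c (F 0) _))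

Σ<-zero : ∀ n F → (∀ i → F i ≡ 0ℚ) → Σ< n F ≡ 0ℚ
Σ<-zero zero F z = refl
Σ<-zero (suc n) F z = trans (cong₂ _+_ (z 0) (Σ<-zero n (F ∘ suc) (z ∘ suc))) refl

Σ<-split : ∀ m n F → Σ< (m ℕ.+ n) F ≡ Σ< m F + Σ< n (λ i → F (m ℕ.+ i))
Σ<-split zero n F = sym (ℚP.+-identityˡ _)
Σ<-split (suc m) n F = trans (cong (F 0 +_) (Σ<-split m n (F ∘ suc))) (sym (ℚP.+-assoc (F 0) _ _))

Σ<-last : ∀ n F → Σ< (suc n) F ≡ Σ< n F + F n
Σ<-last zero F = ℚP.+-comm (F 0) 0ℚ
Σ<-last (suc n) F = trans (cong (F 0 +_) (Σ<-last n (F ∘ suc))) (sym (ℚP.+-assoc (F 0) _ _))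

conv-cong : ∀ n {F G} → (∀ i j → i ℕ.+ j ≡ n → F i j ≡ G i j) → conv n F ≡ conv n G
conv-cong zero eq = eq 0 0 refl
conv-cong (suc n) eq = cong₂ _+_ (eq 0 (suc n) refl) (conv-cong n λ i j e → eq (suc i) j (cong suc e))

conv-+ : ∀ n F G → conv n (λ i j → F i j + G i j) ≡ conv n F + conv n G
conv-+ zero F G = refl
conv-+ (suc n) F G = trans (cong (F 0 (suc n) + G 0 (suc n) +_) (conv-+ n (F ∘ suc) (G ∘ suc)))
  (+-middle (F 0 (suc n)) (G 0 (suc n)) _ _)

conv-* : ∀ n c F → conv n (λ i j → c * F i j) ≡ c * conv n F
conv-* zero c F = refl
conv-* (suc n) c F = trans (cong (c * F 0 (suc n) +_) (conv-* n c (F ∘ suc))) (sym (ℚP.*-distribˡ-+ c (F 0 (suc n)) _))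

conv-zero : ∀ n F → (∀ i j → i ℕ.+ j ≡ n → F i j ≡ 0ℚ) → conv n F ≡ 0ℚ
conv-zero zero F z = z 0 0 refl
conv-zero (suc n) F z = trans (cong₂ _+_ (z 0 (suc n) refl) (conv-zero n (F ∘ suc) λ i j e → z (suc i) j (cong suc e))) refl

conv-last : ∀ n F → conv (suc n) F ≡ conv n (λ i j → F i (suc j)) + F (suc n) 0
conv-last zero F = refl
conv-last (suc n) F = trans (cong (F 0 (suc (suc n)) +_) (conv-last n (F ∘ suc))) (sym (ℚP.+-assoc (F 0 (suc (suc n))) _ _))

conv-comm : ∀ n (F : ℕ → ℕ → ℚ) → conv n F ≡ conv n (flip F)
conv-comm zero F = refl
conv-comm (suc n) F = begin
  F 0 (suc n) + conv n (F ∘ suc)        ≡⟨ ℚP.+-comm (F 0 (suc n)) _ ⟩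
  conv n (F ∘ suc) + F 0 (suc n)        ≡⟨ cong (_+ F 0 (suc n)) (conv-comm n (F ∘ suc)) ⟩
  conv n (flip (F ∘ suc)) + F 0 (suc n) ≡⟨ conv-last n (flip F) ⟨
  conv (suc n) (flip F)                 ∎

-- Both sides run over the triples p + q + k = n; the induction splits off those with p = 0.
conv-assoc : ∀ n (F : ℕ → ℕ → ℕ → ℚ) → conv n (λ i k → conv i (λ p q → F p q k)) ≡ conv n (λ p j → conv j (F p))
conv-assoc zero F = refl
conv-assoc (suc n) F = begin
  F 0 0 (suc n) + conv n (λ i k → F 0 (suc i) k + conv i (λ p q → F (suc p) q k))
    ≡⟨ cong (F 0 0 (suc n) +_) (conv-+ n (λ i k → F 0 (suc i) k) (λ i k → conv i (λ p q → F (suc p) q k))) ⟩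
  F 0 0 (suc n) + (conv n (λ i k → F 0 (suc i) k) + conv n (λ i k → conv i (λ p q → F (suc p) q k)))
    ≡⟨ ℚP.+-assoc (F 0 0 (suc n)) _ _ ⟨
  conv (suc n) (F 0) + conv n (λ i k → conv i (λ p q → F (suc p) q k))
    ≡⟨ cong (conv (suc n) (F 0) +_) (conv-assoc n (F ∘ suc)) ⟩
  conv (suc n) (F 0) + conv n (λ p j → conv j (F (suc p))) ∎

conv-Σ< : ∀ n (F : ℕ → ℚ) → conv n (λ i _ → F i) ≡ Σ< (suc n) F
conv-Σ< zero F = sym (ℚP.+-identityʳ (F 0))
conv-Σ< (suc n) F = cong (F 0 +_) (conv-Σ< n (F ∘ suc))

conv-const : ∀ n (F : ℕ → ℕ → ℚ) → conv n F ≡ Σ< (suc n) (λ i → F i (n ∸ i))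
conv-const n F = trans (conv-cong n λ { i j refl → cong (F i) (sym (ℕP.m+n∸m≡n i j)) }) (conv-Σ< n λ i → F i (n ∸ i))

-- Compares a sum cut off by the exponent of a variable with one cut off by the degree of a factor,
-- in `hProd-coproduct`.
conv-truncate : ∀ m n (F : ℕ → ℚ) → (∀ i → m < i ⊎ n < i → F i ≡ 0ℚ) → conv m (λ i _ → F i) ≡ conv n (λ i _ → F i)
conv-truncate zero zero F z = refl
conv-truncate zero (suc n) F z = sym (trans (cong (F 0 +_) (conv-zero n (λ i _ → F (suc i)) λ i _ _ → z (suc i) (inj₁ (s≤s z≤n)))) (ℚP.+-identityʳ (F 0)))
conv-truncate (suc m) zero F z = trans (cong (F 0 +_) (conv-zero m (λ i _ → F (suc i)) λ i _ _ → z (suc i) (inj₂ (s≤s z≤n)))) (ℚP.+-identityʳ (F 0))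
conv-truncate (suc m) (suc n) F z = cong (F 0 +_) (conv-truncate m n (F ∘ suc) λ
  { i (inj₁ p) → z (suc i) (inj₁ (s≤s p)) ; i (inj₂ p) → z (suc i) (inj₂ (s≤s p)) })

-- Products of series

-- The same Cauchy product as `⋆`, but by recursion on the exponent vector, so that proofs can peel
-- off one variable at a time.
infixl 7 _⊛_
_⊛_ : Series → Series → Series
(S ⊛ U) [] = S [] * U []
(S ⊛ U) (x ∷ α) = conv x (λ i j → ((S ∘ (i ∷_)) ⊛ (U ∘ (j ∷_))) α)

infixl 6 _⊕_
_⊕_ : Series → Series → Series
(S ⊕ U) α = S α + U α

infixl 7 _⊙_
_⊙_ : ℚ → Series → Series
(c ⊙ S) α = c * S α

𝟘 : Series
𝟘 _ = 0ℚ

-- A coefficient of a product involves only coefficients of no larger degree. This lets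
-- `partialRM1-C` multiply identities known in bounded degree only.
⊛-cong-≤ : ∀ {S S' U U'} α → (∀ β → size β ≤ size α → S β ≡ S' β) → (∀ β → size β ≤ size α → U β ≡ U' β) →
  (S ⊛ U) α ≡ (S' ⊛ U') α
⊛-cong-≤ [] e f = cong₂ _*_ (e [] z≤n) (f [] z≤n)
⊛-cong-≤ (x ∷ α) e f = conv-cong x λ i j i+j≡x → ⊛-cong-≤ α
  (λ β β≤ → e (i ∷ β) (ℕP.+-mono-≤ (subst (i ≤_) i+j≡x (ℕP.m≤m+n i j)) β≤))
  (λ β β≤ → f (j ∷ β) (ℕP.+-mono-≤ (subst (j ≤_) i+j≡x (ℕP.m≤n+m j i)) β≤))

⊛-cong : ∀ {S S' U U'} → S ≗ S' → U ≗ U' → S ⊛ U ≗ S' ⊛ U'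
⊛-cong e f α = ⊛-cong-≤ α (λ β _ → e β) (λ β _ → f β)

⊛-comm : ∀ S U → S ⊛ U ≗ U ⊛ S
⊛-comm S U [] = ℚP.*-comm (S []) (U [])
⊛-comm S U (x ∷ α) = trans (conv-comm x _) (conv-cong x λ i j _ → ⊛-comm (S ∘ (j ∷_)) (U ∘ (i ∷_)) α)

-- Covers the coefficients of all linear operators below. Series are compared pointwise, so
-- compatibility with `≗` is a field of its own.
record Linear (φ : Series → ℚ) : Set where
  field
    ext : ∀ {S U} → S ≗ U → φ S ≡ φ U
    add : ∀ S U → φ (S ⊕ U) ≡ φ S + φ U
    scale : ∀ c S → φ (c ⊙ S) ≡ c * φ S

  zero-at : ∀ {S} → S ≗ 𝟘 → φ S ≡ 0ℚ
  zero-at {S} e = begin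
    φ S          ≡⟨ ext (λ α → trans (e α) (sym (ℚP.*-zeroˡ 0ℚ))) ⟩
    φ (0ℚ ⊙ 𝟘)   ≡⟨ scale 0ℚ 𝟘 ⟩
    0ℚ * φ 𝟘     ≡⟨ ℚP.*-zeroˡ (φ 𝟘) ⟩
    0ℚ           ∎

  conv-out : ∀ n (F : ℕ → ℕ → Series) → φ (λ α → conv n (λ i j → F i j α)) ≡ conv n (λ i j → φ (F i j))
  conv-out zero F = refl
  conv-out (suc n) F = trans (add (F 0 (suc n)) _) (cong (φ (F 0 (suc n)) +_) (conv-out n (F ∘ suc)))

  Σ<-out : ∀ n (F : ℕ → Series) → φ (λ α → Σ< n (λ i → F i α)) ≡ Σ< n (λ i → φ (F i))
  Σ<-out zero F = zero-at λ _ → refl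
  Σ<-out (suc n) F = trans (add (F 0) _) (cong (φ (F 0) +_) (Σ<-out n (F ∘ suc)))

  -- Fubini for two sets of variables: `φ` acts on the variables of the series `G γ`, whereas `⊛`
  -- multiplies in the exponents `γ`.
  ⊛-out : ∀ A (G : List ℕ → Series) β → φ (λ α → (A ⊛ (λ γ → G γ α)) β) ≡ (A ⊛ (λ γ → φ (G γ))) β
  ⊛-out A G [] = scale (A []) (G [])
  ⊛-out A G (x ∷ β) = trans (conv-out x _) (conv-cong x λ i j _ → ⊛-out (A ∘ (i ∷_)) (G ∘ (j ∷_)) β)

open Linear

⊛-linearʳ : ∀ A α → Linear (λ S → (A ⊛ S) α)
⊛-linearʳ A α .ext e = ⊛-cong {A} (λ _ → refl) e α
⊛-linearʳ A [] .add S U = ℚP.*-distribˡ-+ (A []) (S []) (U [])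
⊛-linearʳ A (x ∷ α) .add S U = trans
  (conv-cong x λ i j _ → ⊛-linearʳ (A ∘ (i ∷_)) α .add (S ∘ (j ∷_)) (U ∘ (j ∷_))) (conv-+ x _ _)
⊛-linearʳ A [] .scale c S = *-swapˡ (A []) c (S [])
⊛-linearʳ A (x ∷ α) .scale c S = trans
  (conv-cong x λ i j _ → ⊛-linearʳ (A ∘ (i ∷_)) α .scale c (S ∘ (j ∷_))) (conv-* x c _)

⊛-linearˡ : ∀ A α → Linear (λ S → (S ⊛ A) α)
⊛-linearˡ A α .ext e = ⊛-cong {U = A} e (λ _ → refl) α
⊛-linearˡ A α .add S U = begin
  ((S ⊕ U) ⊛ A) α       ≡⟨ ⊛-comm (S ⊕ U) A α ⟩
  (A ⊛ (S ⊕ U)) α       ≡⟨ ⊛-linearʳ A α .add S U ⟩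
  (A ⊛ S) α + (A ⊛ U) α ≡⟨ cong₂ _+_ (⊛-comm A S α) (⊛-comm A U α) ⟩
  (S ⊛ A) α + (U ⊛ A) α ∎
⊛-linearˡ A α .scale c S = begin
  ((c ⊙ S) ⊛ A) α ≡⟨ ⊛-comm (c ⊙ S) A α ⟩
  (A ⊛ (c ⊙ S)) α ≡⟨ ⊛-linearʳ A α .scale c S ⟩
  c * (A ⊛ S) α   ≡⟨ cong (c *_) (⊛-comm A S α) ⟩
  c * (S ⊛ A) α   ∎

⊛-assoc : ∀ S U V → (S ⊛ U) ⊛ V ≗ S ⊛ (U ⊛ V)
⊛-assoc S U V [] = ℚP.*-assoc (S []) (U []) (V [])
⊛-assoc S U V (x ∷ α) = begin
  conv x (λ i k → ((λ β → conv i (λ p q → ((S ∘ (p ∷_)) ⊛ (U ∘ (q ∷_))) β)) ⊛ (V ∘ (k ∷_))) α)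
    ≡⟨ conv-cong x (λ i k _ → conv-out (⊛-linearˡ (V ∘ (k ∷_)) α) i _) ⟩
  conv x (λ i k → conv i (λ p q → ((S ∘ (p ∷_)) ⊛ (U ∘ (q ∷_)) ⊛ (V ∘ (k ∷_))) α))
    ≡⟨ conv-assoc x (λ p q k → ((S ∘ (p ∷_)) ⊛ (U ∘ (q ∷_)) ⊛ (V ∘ (k ∷_))) α) ⟩
  conv x (λ p j → conv j (λ q k → ((S ∘ (p ∷_)) ⊛ (U ∘ (q ∷_)) ⊛ (V ∘ (k ∷_))) α))
    ≡⟨ conv-cong x (λ p j _ → conv-cong j λ q k _ → ⊛-assoc (S ∘ (p ∷_)) (U ∘ (q ∷_)) (V ∘ (k ∷_)) α) ⟩
  conv x (λ p j → conv j (λ q k → ((S ∘ (p ∷_)) ⊛ ((U ∘ (q ∷_)) ⊛ (V ∘ (k ∷_)))) α))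
    ≡⟨ conv-cong x (λ p j _ → conv-out (⊛-linearʳ (S ∘ (p ∷_)) α) j _) ⟨
  conv x (λ p j → ((S ∘ (p ∷_)) ⊛ ((U ⊛ V) ∘ (j ∷_))) α) ∎

⊛-swap : ∀ S U V → S ⊛ (U ⊛ V) ≗ U ⊛ (S ⊛ V)
⊛-swap S U V α = begin
  (S ⊛ (U ⊛ V)) α ≡⟨ ⊛-assoc S U V α ⟨
  (S ⊛ U ⊛ V) α   ≡⟨ ⊛-cong {U = V} (⊛-comm S U) (λ _ → refl) α ⟩
  (U ⊛ S ⊛ V) α   ≡⟨ ⊛-assoc U S V α ⟩
  (U ⊛ (S ⊛ V)) α ∎

-- Comparison of the list-based product with the recursive one.

sumℚ-++ : ∀ xs ys → sumℚ (xs ++ ys) ≡ sumℚ xs + sumℚ ys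
sumℚ-++ [] ys = sym (ℚP.+-identityˡ _)
sumℚ-++ (x ∷ xs) ys = trans (cong (x +_) (sumℚ-++ xs ys)) (sym (ℚP.+-assoc x _ _))

sumℚ-applyUpTo : ∀ {A : Set} (F : A → ℚ) (f : ℕ → A) n → sumℚ (map F (applyUpTo f n)) ≡ Σ< n (F ∘ f)
sumℚ-applyUpTo F f zero = refl
sumℚ-applyUpTo F f (suc n) = cong (F (f 0) +_) (sumℚ-applyUpTo F (f ∘ suc) n)

sumℚ-upTo : ∀ F n → sumℚ (map F (upTo n)) ≡ Σ< n F
sumℚ-upTo F n = sumℚ-applyUpTo F id n

sumℚ-concatMap : ∀ {A B : Set} (F : B → ℚ) (f : A → List B) xs →
  sumℚ (map F (concatMap f xs)) ≡ sumℚ (map (λ x → sumℚ (map F (f x))) xs)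
sumℚ-concatMap F f [] = refl
sumℚ-concatMap F f (x ∷ xs) = begin
  sumℚ (map F (f x ++ concatMap f xs))                   ≡⟨ cong sumℚ (LP.map-++ F (f x) _) ⟩
  sumℚ (map F (f x) ++ map F (concatMap f xs))           ≡⟨ sumℚ-++ (map F (f x)) _ ⟩
  sumℚ (map F (f x)) + sumℚ (map F (concatMap f xs))     ≡⟨ cong (sumℚ (map F (f x)) +_) (sumℚ-concatMap F f xs) ⟩
  sumℚ (map F (f x)) + sumℚ (map (λ y → sumℚ (map F (f y))) xs) ∎

⋆≗⊛ : ∀ S U → S ⋆ U ≗ S ⊛ U
⋆≗⊛ S U [] = ℚP.+-identityʳ _
⋆≗⊛ S U (x ∷ α) = begin
  sumℚ (map F (concatMap (λ b → map (b ∷_) (below α)) (upTo (suc x))))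
    ≡⟨ sumℚ-concatMap F (λ b → map (b ∷_) (below α)) (upTo (suc x)) ⟩
  sumℚ (map (λ b → sumℚ (map F (map (b ∷_) (below α)))) (upTo (suc x)))
    ≡⟨ sumℚ-upTo (λ b → sumℚ (map F (map (b ∷_) (below α)))) (suc x) ⟩
  Σ< (suc x) (λ b → sumℚ (map F (map (b ∷_) (below α))))
    ≡⟨ Σ<-cong (suc x) (λ b _ → trans (cong sumℚ (sym (LP.map-∘ {g = F} {f = b ∷_} (below α)))) (⋆≗⊛ (S ∘ (b ∷_)) (U ∘ (x ∸ b ∷_)) α)) ⟩
  Σ< (suc x) (λ b → ((S ∘ (b ∷_)) ⊛ (U ∘ (x ∸ b ∷_))) α)
    ≡⟨ conv-const x _ ⟨
  (S ⊛ U) (x ∷ α) ∎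
  where
  F : List ℕ → ℚ
  F β = S β * U (zipWith _∸_ (x ∷ α) β)

-- The shifted complete homogeneous series

ind : Bool → ℚ
ind b = if b then 1ℚ else 0ℚ

-- hd k r is the complete homogeneous series of degree r − k (and 0 if r < k), so that
-- the coefficient of x^k in h_r as a series in the first variable is hd k r.
hd : ℕ → ℕ → Series
hd k r α = ind (k ℕ.+ size α ≡ᵇ r)

hd-∷ : ∀ k r i → hd k r ∘ (i ∷_) ≗ hd (k ℕ.+ i) r
hd-∷ k r i α = cong (λ n → ind (n ≡ᵇ r)) (sym (ℕP.+-assoc k i (size α)))

hd-shift : ∀ m k r → hd (m ℕ.+ k) (m ℕ.+ r) ≗ hd k r
hd-shift zero k r α = refl
hd-shift (suc m) k r α = hd-shift m k r α

≡ᵇ-> : ∀ m n → n < m → (m ≡ᵇ n) ≡ false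
≡ᵇ-> (suc m) zero _ = refl
≡ᵇ-> (suc m) (suc n) (s≤s p) = ≡ᵇ-> m n p

hd-zero : ∀ k r → r < k → hd k r ≗ 𝟘
hd-zero k r r<k α = cong ind (≡ᵇ-> (k ℕ.+ size α) r (ℕP.<-≤-trans r<k (ℕP.m≤m+n k _)))

conv-ind-zero : ∀ x i (V : ℕ → ℚ) → x < i → conv x (λ b c → ind (b ≡ᵇ i) * V c) ≡ 0ℚ
conv-ind-zero zero (suc i) V p = ℚP.*-zeroˡ (V 0)
conv-ind-zero (suc x) (suc i) V (s≤s p) = trans (cong₂ _+_ (ℚP.*-zeroˡ (V (suc x))) (conv-ind-zero x i V p)) refl

conv-ind : ∀ i j (V : ℕ → ℚ) → conv (i ℕ.+ j) (λ b c → ind (b ≡ᵇ i) * V c) ≡ V j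
conv-ind zero zero V = ℚP.*-identityˡ (V 0)
conv-ind zero (suc j) V = trans (cong₂ _+_ (ℚP.*-identityˡ (V (suc j)))
  (conv-zero j (λ b c → 0ℚ * V c) λ _ c _ → ℚP.*-zeroˡ (V c))) (ℚP.+-identityʳ _)
conv-ind (suc i) j V = trans (cong₂ _+_ (ℚP.*-zeroˡ (V (suc (i ℕ.+ j)))) (conv-ind i j V)) (ℚP.+-identityˡ _)

hS0-unitˡ : ∀ S → hS 0 ⊛ S ≗ S
hS0-unitˡ S [] = ℚP.*-identityˡ (S [])
hS0-unitˡ S (x ∷ α) = begin
  conv x (λ b c → ((hS 0 ∘ (b ∷_)) ⊛ (S ∘ (c ∷_))) α) ≡⟨ conv-cong x (λ b c _ → lem b c) ⟩
  conv x (λ b c → ind (b ≡ᵇ 0) * S (c ∷ α))           ≡⟨ conv-ind 0 x (λ c → S (c ∷ α)) ⟩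
  S (x ∷ α)                                           ∎
  where
  lem : ∀ b c → ((hS 0 ∘ (b ∷_)) ⊛ (S ∘ (c ∷_))) α ≡ ind (b ≡ᵇ 0) * S (c ∷ α)
  lem zero c = trans (hS0-unitˡ (S ∘ (c ∷_)) α) (sym (ℚP.*-identityˡ _))
  lem (suc b) c = trans (zero-at (⊛-linearˡ (S ∘ (c ∷_)) α) λ _ → refl) (sym (ℚP.*-zeroˡ (S (c ∷ α))))

hS0-unitʳ : ∀ S → S ⊛ hS 0 ≗ S
hS0-unitʳ S α = trans (⊛-comm S (hS 0) α) (hS0-unitˡ S α)

hd-⊛-∷ : ∀ k r S x α → (hd k r ⊛ S) (x ∷ α) ≡ conv x (λ i j → (hd (k ℕ.+ i) r ⊛ (S ∘ (j ∷_))) α)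
hd-⊛-∷ k r S x α = conv-cong x λ i j _ → ⊛-linearˡ (S ∘ (j ∷_)) α .ext (hd-∷ k r i)

hd-⊛-zero : ∀ k r S → r < k → hd k r ⊛ S ≗ 𝟘
hd-⊛-zero k r S r<k α = zero-at (⊛-linearˡ S α) (hd-zero k r r<k)

-- C a f = Σ_j x_j^a f(x with x_j = 0); on symmetric f this is what RM_a^{(1)} turns out to be.
C : ℕ → Series → Series
C a S [] = 0ℚ
C a S (x ∷ α) = ind (x ≡ᵇ a) * S (0 ∷ α) + C a (S ∘ (x ∷_)) α

C-linear : ∀ a α → Linear (λ S → C a S α)
C-linear a [] .ext e = refl
C-linear a (x ∷ α) .ext e = cong₂ _+_ (cong (ind (x ≡ᵇ a) *_) (e (0 ∷ α))) (C-linear a α .ext (e ∘ (x ∷_)))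
C-linear a [] .add S U = refl
C-linear a (x ∷ α) .add S U = trans
  (cong₂ _+_ (ℚP.*-distribˡ-+ (ind (x ≡ᵇ a)) (S (0 ∷ α)) (U (0 ∷ α))) (C-linear a α .add (S ∘ (x ∷_)) (U ∘ (x ∷_))))
  (+-middle (ind (x ≡ᵇ a) * S (0 ∷ α)) _ _ _)
C-linear a [] .scale c S = sym (ℚP.*-zeroʳ c)
C-linear a (x ∷ α) .scale c S = trans
  (cong₂ _+_ (*-swapˡ (ind (x ≡ᵇ a)) c (S (0 ∷ α))) (C-linear a α .scale c (S ∘ (x ∷_))))
  (sym (ℚP.*-distribˡ-+ c (ind (x ≡ᵇ a) * S (0 ∷ α)) _))

-- The pair (i + 1, a) on the left corresponds to (i, a + 1) on the right, which leaves i = 0 apart.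
-- This is the source of the correction term in `C-hd-⊛`.
conv-ind-shift : ∀ a x (Y : ℕ → ℚ) →
  conv x (λ i j → ind (j ≡ᵇ a) * Y i) ≡ ind (x ≡ᵇ a) * Y 0 + conv x (λ i j → ind (j ≡ᵇ suc a) * Y (suc i))
conv-ind-shift a zero Y = sym (trans (cong (ind (0 ≡ᵇ a) * Y 0 +_) (ℚP.*-zeroˡ (Y 1))) (ℚP.+-identityʳ _))
conv-ind-shift a (suc x) Y = cong (ind (suc x ≡ᵇ a) * Y 0 +_) (begin
  conv x (λ i j → ind (j ≡ᵇ a) * Y (suc i))
    ≡⟨ ℚP.+-identityʳ _ ⟨
  conv x (λ i j → ind (j ≡ᵇ a) * Y (suc i)) + 0ℚ
    ≡⟨ cong (conv x (λ i j → ind (j ≡ᵇ a) * Y (suc i)) +_) (ℚP.*-zeroˡ (Y (suc (suc x)))) ⟨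
  conv x (λ i j → ind (j ≡ᵇ a) * Y (suc i)) + ind (0 ≡ᵇ suc a) * Y (suc (suc x))
    ≡⟨ conv-last x (λ i j → ind (j ≡ᵇ suc a) * Y (suc i)) ⟨
  conv (suc x) (λ i j → ind (j ≡ᵇ suc a) * Y (suc i)) ∎)

-- Setting x_j = 0 turns h_r into h_r − x_j h_{r−1}.
C-hd-⊛ : ∀ a k r S α → (hd k r ⊛ C a S) α ≡ C a (hd k r ⊛ S) α + (hd (suc k) r ⊛ C (suc a) S) α
C-hd-⊛ a k r S [] = begin
  hd k r [] * 0ℚ                 ≡⟨ ℚP.*-zeroʳ (hd k r []) ⟩
  0ℚ                             ≡⟨ ℚP.*-zeroʳ (hd (suc k) r []) ⟨
  hd (suc k) r [] * 0ℚ           ≡⟨ ℚP.+-identityˡ _ ⟨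
  0ℚ + hd (suc k) r [] * 0ℚ      ∎
C-hd-⊛ a k r S (x ∷ α) = begin
  (hd k r ⊛ C a S) (x ∷ α)
    ≡⟨ expand k a ⟩
  conv x (λ i j → ind (j ≡ᵇ a) * Y i) + conv x (λ i j → (hd (k ℕ.+ i) r ⊛ C a (S ∘ (j ∷_))) α)
    ≡⟨ cong₂ _+_ (conv-ind-shift a x Y) (conv-cong x λ i j _ → C-hd-⊛ a (k ℕ.+ i) r (S ∘ (j ∷_)) α) ⟩
  (ind (x ≡ᵇ a) * Y 0 + conv x Y₁) + conv x (λ i j → C a (hd (k ℕ.+ i) r ⊛ (S ∘ (j ∷_))) α + Z i j)
    ≡⟨ cong (ind (x ≡ᵇ a) * Y 0 + conv x Y₁ +_) (conv-+ x (λ i j → C a (hd (k ℕ.+ i) r ⊛ (S ∘ (j ∷_))) α) Z) ⟩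
  (ind (x ≡ᵇ a) * Y 0 + conv x Y₁) + (conv x (λ i j → C a (hd (k ℕ.+ i) r ⊛ (S ∘ (j ∷_))) α) + conv x Z)
    -- The term with i = 0 and the sum over `C a` form `C a (hd k r ⊛ S)`; the other two sums are
    -- `expand` at `suc k` and `suc a`.
    ≡⟨ +-middle (ind (x ≡ᵇ a) * Y 0) (conv x Y₁) _ (conv x Z) ⟩
  (ind (x ≡ᵇ a) * Y 0 + conv x (λ i j → C a (hd (k ℕ.+ i) r ⊛ (S ∘ (j ∷_))) α)) + (conv x Y₁ + conv x Z)
    ≡⟨ cong₂ _+_ (cong₂ _+_ (cong (ind (x ≡ᵇ a) *_) lhs₀) lhs₁) rhs ⟩
  C a (hd k r ⊛ S) (x ∷ α) + (hd (suc k) r ⊛ C (suc a) S) (x ∷ α) ∎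
  where
  Y : ℕ → ℚ
  Y i = (hd (k ℕ.+ i) r ⊛ (S ∘ (0 ∷_))) α

  Y₁ Z : ℕ → ℕ → ℚ
  Y₁ i j = ind (j ≡ᵇ suc a) * Y (suc i)
  Z i j = (hd (suc (k ℕ.+ i)) r ⊛ C (suc a) (S ∘ (j ∷_))) α

  expand : ∀ k a → (hd k r ⊛ C a S) (x ∷ α) ≡
    conv x (λ i j → ind (j ≡ᵇ a) * (hd (k ℕ.+ i) r ⊛ (S ∘ (0 ∷_))) α) +
    conv x (λ i j → (hd (k ℕ.+ i) r ⊛ C a (S ∘ (j ∷_))) α)
  expand k a = begin
    (hd k r ⊛ C a S) (x ∷ α)
      ≡⟨ hd-⊛-∷ k r (C a S) x α ⟩
    conv x (λ i j → (hd (k ℕ.+ i) r ⊛ (C a S ∘ (j ∷_))) α)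
      ≡⟨ conv-cong x (λ i j _ → let L = ⊛-linearʳ (hd (k ℕ.+ i) r) α in
           trans (L .add (ind (j ≡ᵇ a) ⊙ (S ∘ (0 ∷_))) (C a (S ∘ (j ∷_))))
                 (cong (_+ (hd (k ℕ.+ i) r ⊛ C a (S ∘ (j ∷_))) α) (L .scale (ind (j ≡ᵇ a)) (S ∘ (0 ∷_))))) ⟩
    conv x (λ i j → ind (j ≡ᵇ a) * (hd (k ℕ.+ i) r ⊛ (S ∘ (0 ∷_))) α + (hd (k ℕ.+ i) r ⊛ C a (S ∘ (j ∷_))) α)
      ≡⟨ conv-+ x (λ i j → ind (j ≡ᵇ a) * (hd (k ℕ.+ i) r ⊛ (S ∘ (0 ∷_))) α) (λ i j → (hd (k ℕ.+ i) r ⊛ C a (S ∘ (j ∷_))) α) ⟩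
    conv x (λ i j → ind (j ≡ᵇ a) * (hd (k ℕ.+ i) r ⊛ (S ∘ (0 ∷_))) α) +
    conv x (λ i j → (hd (k ℕ.+ i) r ⊛ C a (S ∘ (j ∷_))) α) ∎

  lhs₀ : Y 0 ≡ (hd k r ⊛ S) (0 ∷ α)
  lhs₀ = sym (hd-⊛-∷ k r S 0 α)

  lhs₁ : conv x (λ i j → C a (hd (k ℕ.+ i) r ⊛ (S ∘ (j ∷_))) α) ≡ C a ((hd k r ⊛ S) ∘ (x ∷_)) α
  lhs₁ = trans (sym (conv-out (C-linear a α) x (λ i j → hd (k ℕ.+ i) r ⊛ (S ∘ (j ∷_)))))
    (C-linear a α .ext λ β → sym (hd-⊛-∷ k r S x β))

  rhs : conv x Y₁ + conv x Z ≡ (hd (suc k) r ⊛ C (suc a) S) (x ∷ α)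
  rhs = trans (cong (_+ conv x Z) (conv-cong x λ i j _ →
      cong (λ n → ind (j ≡ᵇ suc a) * (hd n r ⊛ (S ∘ (0 ∷_))) α) (ℕP.+-suc k i)))
    (sym (expand (suc k) (suc a)))

-- Products of complete homogeneous series

hProd-∷ : ∀ r τ → hProd (r ∷ τ) ≗ hS r ⊛ hProd τ
hProd-∷ r τ = ⋆≗⊛ (hS r) (hProd τ)

hProd-∷-cong : ∀ r μ ν → hProd μ ≗ hProd ν → hProd (r ∷ μ) ≗ hProd (r ∷ ν)
hProd-∷-cong r μ ν e α = begin
  hProd (r ∷ μ) α    ≡⟨ hProd-∷ r μ α ⟩
  (hS r ⊛ hProd μ) α ≡⟨ ⊛-linearʳ (hS r) α .ext e ⟩
  (hS r ⊛ hProd ν) α ≡⟨ hProd-∷ r ν α ⟨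
  hProd (r ∷ ν) α    ∎

hProd-swap : ∀ r s μ → hProd (r ∷ s ∷ μ) ≗ hProd (s ∷ r ∷ μ)
hProd-swap r s μ α = begin
  hProd (r ∷ s ∷ μ) α         ≡⟨ expand r s ⟩
  (hS r ⊛ (hS s ⊛ hProd μ)) α ≡⟨ ⊛-swap (hS r) (hS s) (hProd μ) α ⟩
  (hS s ⊛ (hS r ⊛ hProd μ)) α ≡⟨ expand s r ⟨
  hProd (s ∷ r ∷ μ) α         ∎
  where
  expand : ∀ r s → hProd (r ∷ s ∷ μ) α ≡ (hS r ⊛ (hS s ⊛ hProd μ)) α
  expand r s = trans (hProd-∷ r (s ∷ μ) α) (⊛-linearʳ (hS r) α .ext (hProd-∷ s μ))

hProd-insertDesc : ∀ x ys → hProd (insertDesc x ys) ≗ hProd (x ∷ ys)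
hProd-insertDesc x [] α = refl
hProd-insertDesc x (y ∷ ys) α with y ≤ᵇ x
... | true = refl
... | false = trans (hProd-∷-cong y (insertDesc x ys) (x ∷ ys) (hProd-insertDesc x ys) α) (hProd-swap y x ys α)

hProd-normalizeˡ : ∀ μ → hProd (normalize μ) ≗ hProd μ
hProd-normalizeˡ [] α = refl
hProd-normalizeˡ (zero ∷ μ) α = begin
  hProd (normalize μ) α ≡⟨ hProd-normalizeˡ μ α ⟩
  hProd μ α             ≡⟨ hS0-unitˡ (hProd μ) α ⟨
  (hS 0 ⊛ hProd μ) α    ≡⟨ hProd-∷ 0 μ α ⟨
  hProd (0 ∷ μ) α       ∎
hProd-normalizeˡ (suc x ∷ μ) α = trans (hProd-insertDesc (suc x) (normalize μ) α)
  (hProd-∷-cong (suc x) (normalize μ) μ (hProd-normalizeˡ μ) α)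

hProd-++ : ∀ μ ν → hProd (μ ++ ν) ≗ hProd μ ⊛ hProd ν
hProd-++ [] ν α = sym (hS0-unitˡ (hProd ν) α)
hProd-++ (r ∷ μ) ν α = begin
  hProd (r ∷ μ ++ ν) α             ≡⟨ hProd-∷ r (μ ++ ν) α ⟩
  (hS r ⊛ hProd (μ ++ ν)) α        ≡⟨ ⊛-linearʳ (hS r) α .ext (hProd-++ μ ν) ⟩
  (hS r ⊛ (hProd μ ⊛ hProd ν)) α   ≡⟨ ⊛-assoc (hS r) (hProd μ) (hProd ν) α ⟨
  (hS r ⊛ hProd μ ⊛ hProd ν) α     ≡⟨ ⊛-linearˡ (hProd ν) α .ext (hProd-∷ r μ) ⟨
  (hProd (r ∷ μ) ⊛ hProd ν) α      ∎

-- The constant term of h_τ is 1 exactly when all parts of τ are zero, that is, when τ has size 0.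
-- This starts the induction in `hProd-sym`.
hProd-[] : ∀ τ → hProd τ [] ≡ hProd [] τ
hProd-[] [] = refl
hProd-[] (zero ∷ τ) = trans (hProd-∷ 0 τ []) (trans (ℚP.*-identityˡ _) (hProd-[] τ))
hProd-[] (suc r ∷ τ) = trans (hProd-∷ (suc r) τ []) (ℚP.*-zeroˡ (hProd τ []))

hS-as-hd : ∀ {i j n} → i ℕ.+ j ≡ n → hS j ≗ hd i n
hS-as-hd {i} {j} refl α = trans (sym (hd-shift i 0 j α)) (cong (λ m → hd m (i ℕ.+ j) α) (ℕP.+-identityʳ i))

-- h_τ(x₁, x₂, …) is the generating series of products ∏ h_{β_j}(x₂, …) over the ways
-- of splitting off x₁^{τ_j − β_j} from each factor.
hProd-coproduct : ∀ τ x α → hProd τ (x ∷ α) ≡ (hS x ⊛ (λ σ → hProd σ α)) τ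
hProd-coproduct [] zero α = sym (ℚP.*-identityˡ _)
hProd-coproduct [] (suc x) α = sym (ℚP.*-zeroˡ (hProd [] α))
hProd-coproduct (r ∷ τ) x α = begin
  hProd (r ∷ τ) (x ∷ α)
    ≡⟨ hProd-∷ r τ (x ∷ α) ⟩
  (hS r ⊛ hProd τ) (x ∷ α)
    ≡⟨ hd-⊛-∷ 0 r (hProd τ) x α ⟩
  conv x (λ i j → (hd i r ⊛ (hProd τ ∘ (j ∷_))) α)
    ≡⟨ conv-cong x (λ i j _ → ⊛-linearʳ (hd i r) α .ext (hProd-coproduct τ j)) ⟩
  conv x (λ i j → (hd i r ⊛ (λ β → (hS j ⊛ (λ σ → hProd σ β)) τ)) α)
    ≡⟨ conv-cong x (λ i j _ → ⊛-out (⊛-linearʳ (hd i r) α) (hS j) hProd τ) ⟩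
  conv x (λ i j → (hS j ⊛ (λ σ → (hd i r ⊛ hProd σ) α)) τ)
    ≡⟨ conv-cong x (λ i j e → ⊛-linearˡ (λ σ → (hd i r ⊛ hProd σ) α) τ .ext (hS-as-hd e)) ⟩
  conv x (λ i _ → F i)
    -- Here `i` is the exponent of x₁ taken from the factor h_r: one sum bounds it by x, the other
    -- by r.
    ≡⟨ conv-truncate x r F vanish ⟩
  conv r (λ i _ → F i)
    ≡⟨ conv-cong r (λ i j e → ⊛-linearʳ (hd i x) τ .ext λ σ →
         trans (hProd-∷ j σ α) (⊛-linearˡ (hProd σ) α .ext (hS-as-hd e))) ⟨
  conv r (λ i j → (hd i x ⊛ (λ σ → hProd (j ∷ σ) α)) τ)
    ≡⟨ hd-⊛-∷ 0 x (λ σ → hProd σ α) r τ ⟨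
  (hS x ⊛ (λ σ → hProd σ α)) (r ∷ τ) ∎
  where
  F : ℕ → ℚ
  F i = (hd i x ⊛ (λ σ → (hd i r ⊛ hProd σ) α)) τ

  vanish : ∀ i → x < i ⊎ r < i → F i ≡ 0ℚ
  vanish i (inj₁ x<i) = hd-⊛-zero i x _ x<i τ
  vanish i (inj₂ r<i) = zero-at (⊛-linearʳ (hd i x) τ) λ σ → hd-⊛-zero i r (hProd σ) r<i α

-- Both sides count matrices of naturals with row sums τ and column sums α, up to transposition.
-- `hProd-coproduct` splits off a column, which matches the first factor of h_α.
hProd-sym : ∀ α τ → hProd τ α ≡ hProd α τ
hProd-sym [] τ = hProd-[] τ
hProd-sym (x ∷ α) τ = begin
  hProd τ (x ∷ α)                ≡⟨ hProd-coproduct τ x α ⟩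
  (hS x ⊛ (λ σ → hProd σ α)) τ   ≡⟨ ⊛-linearʳ (hS x) τ .ext (hProd-sym α) ⟩
  (hS x ⊛ hProd α) τ             ≡⟨ hProd-∷ x α τ ⟨
  hProd (x ∷ α) τ                ∎

-- Through `hProd-sym`, symmetry of h_τ in the variables becomes commutativity of the product h_α
-- together with h_0 = 1.
hProd-normalize : ∀ τ α → hProd τ (normalize α) ≡ hProd τ α
hProd-normalize τ α = begin
  hProd τ (normalize α) ≡⟨ hProd-sym (normalize α) τ ⟩
  hProd (normalize α) τ ≡⟨ hProd-normalizeˡ α τ ⟩
  hProd α τ             ≡⟨ hProd-sym α τ ⟨
  hProd τ α             ∎

-- The span of the h_τ

-- Linear identities are checked on the products h_τ and extended by induction on membership.
data Span : Series → Set where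
  hprod  : ∀ τ → Span (hProd τ)
  _⊕ˢ_   : ∀ {S U} → Span S → Span U → Span (S ⊕ U)
  _⊙ˢ_   : ∀ c {S} → Span S → Span (c ⊙ S)
  respˢ  : ∀ {S U} → S ≗ U → Span S → Span U

Span-normalize : ∀ {S} → Span S → ∀ α → S (normalize α) ≡ S α
Span-normalize (hprod τ) α = hProd-normalize τ α
Span-normalize (s ⊕ˢ u) α = cong₂ _+_ (Span-normalize s α) (Span-normalize u α)
Span-normalize (c ⊙ˢ s) α = cong (c *_) (Span-normalize s α)
Span-normalize (respˢ e s) α = trans (sym (e (normalize α))) (trans (Span-normalize s α) (e α))

Span-𝟘 : Span 𝟘
Span-𝟘 = respˢ (λ α → ℚP.*-zeroˡ (hProd [] α)) (0ℚ ⊙ˢ hprod [])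

Span-conv : ∀ n {F : ℕ → ℕ → Series} → (∀ i j → Span (F i j)) → Span (λ α → conv n (λ i j → F i j α))
Span-conv zero s = s 0 0
Span-conv (suc n) s = s 0 (suc n) ⊕ˢ Span-conv n λ i j → s (suc i) j

Span-Σ< : ∀ n {F : ℕ → Series} → (∀ i → i < n → Span (F i)) → Span (λ α → Σ< n (λ i → F i α))
Span-Σ< zero s = Span-𝟘
Span-Σ< (suc n) s = s 0 (s≤s z≤n) ⊕ˢ Span-Σ< n λ i i<n → s (suc i) (s≤s i<n)

Span-⊛-hProd : ∀ {S} τ → Span S → Span (hProd τ ⊛ S)
Span-⊛-hProd τ (hprod σ) = respˢ (hProd-++ τ σ) (hprod (τ ++ σ))
Span-⊛-hProd τ (_⊕ˢ_ {S} {U} s u) =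
  respˢ (λ α → sym (⊛-linearʳ (hProd τ) α .add S U)) (Span-⊛-hProd τ s ⊕ˢ Span-⊛-hProd τ u)
Span-⊛-hProd τ (_⊙ˢ_ c {S} s) = respˢ (λ α → sym (⊛-linearʳ (hProd τ) α .scale c S)) (c ⊙ˢ Span-⊛-hProd τ s)
Span-⊛-hProd τ (respˢ e s) = respˢ (λ α → ⊛-linearʳ (hProd τ) α .ext e) (Span-⊛-hProd τ s)

Span-⊛ : ∀ {S U} → Span S → Span U → Span (S ⊛ U)
Span-⊛ (hprod τ) u = Span-⊛-hProd τ u
Span-⊛ {U = U} (_⊕ˢ_ {S} {S'} s s') u =
  respˢ (λ α → sym (⊛-linearˡ U α .add S S')) (Span-⊛ s u ⊕ˢ Span-⊛ s' u)
Span-⊛ {U = U} (_⊙ˢ_ c {S} s) u = respˢ (λ α → sym (⊛-linearˡ U α .scale c S)) (c ⊙ˢ Span-⊛ s u)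
Span-⊛ {U = U} (respˢ e s) u = respˢ (λ α → ⊛-linearˡ U α .ext e) (Span-⊛ s u)

Span-hS : ∀ r → Span (hS r)
Span-hS r = respˢ (λ α → trans (hProd-∷ r [] α) (hS0-unitʳ (hS r) α)) (hprod (r ∷ []))

Span-hd : ∀ k r → Span (hd k r)
Span-hd k r with ℕP.≤-<-connex k r
... | inj₁ k≤r = respˢ (hS-as-hd (ℕP.m+[n∸m]≡n k≤r)) (Span-hS (r ∸ k))
... | inj₂ r<k = respˢ (sym ∘ hd-zero k r r<k) Span-𝟘

Span-∷-hProd : ∀ τ x → Span (hProd τ ∘ (x ∷_))
Span-∷-hProd [] x = respˢ (λ α → sym (hd-∷ 0 0 x α)) (Span-hd x 0)
Span-∷-hProd (r ∷ τ) x = respˢ (λ α → sym (trans (hProd-∷ r τ (x ∷ α)) (hd-⊛-∷ 0 r (hProd τ) x α)))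
  (Span-conv x λ i j → Span-⊛ (Span-hd i r) (Span-∷-hProd τ j))

-- On symmetric series, taking the coefficient of x₁^x is h_x^⊥; this stability is what places
-- (h_a^k)^⊥ m_λ in the span.
Span-∷ : ∀ {S} x → Span S → Span (S ∘ (x ∷_))
Span-∷ x (hprod τ) = Span-∷-hProd τ x
Span-∷ x (s ⊕ˢ u) = Span-∷ x s ⊕ˢ Span-∷ x u
Span-∷ x (c ⊙ˢ s) = c ⊙ˢ Span-∷ x s
Span-∷ x (respˢ e s) = respˢ (e ∘ (x ∷_)) (Span-∷ x s)

-- Newton's identities and the recursion for `C` give the wanted series `V` only as a summand of a
-- known one.
Span-⊖ : ∀ {S U V} → Span S → Span U → (∀ α → S α ≡ V α + U α) → Span V
Span-⊖ {S} {U} {V} s u e = respˢ (λ α → trans (cong (_+ (- 1ℚ) * U α) (e α)) (+-cancel (V α) (U α))) (s ⊕ˢ ((- 1ℚ) ⊙ˢ u))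

-- Power sums and Newton's identities.

ι : ℕ → ℚ
ι zero = 0ℚ
ι (suc n) = 1ℚ + ι n

ι-+ : ∀ m n → ι (m ℕ.+ n) ≡ ι m + ι n
ι-+ zero n = sym (ℚP.+-identityˡ (ι n))
ι-+ (suc m) n = trans (cong (1ℚ +_) (ι-+ m n)) (sym (ℚP.+-assoc 1ℚ (ι m) (ι n)))

-- The power sum p_a for a > 0; P 0 is not a power sum.
P : ℕ → Series
P a = C a (hS 0)

-- This is the splitting p_i = x₁^i + p_i(x₂, ...), read off at x₁^b.
P-∷ : ∀ i b → P i ∘ (b ∷_) ≗ (ind (b ≡ᵇ i) ⊙ hS 0) ⊕ (ind (b ≡ᵇ 0) ⊙ P i)
P-∷ i b α = cong (ind (b ≡ᵇ i) * hS 0 α +_) (lem b)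
  where
  lem : ∀ b → C i (hS 0 ∘ (b ∷_)) α ≡ ind (b ≡ᵇ 0) * P i α
  lem zero = sym (ℚP.*-identityˡ _)
  lem (suc b) = trans (zero-at (C-linear i α) λ _ → refl) (sym (ℚP.*-zeroˡ (P i α)))

Σ<-indicator : ∀ x N (W : ℕ → ℚ) V → x ≤ N → (∀ i → i < x → W i ≡ V) → (∀ i → x ≤ i → W i ≡ 0ℚ) → Σ< N W ≡ ι x * V
Σ<-indicator zero N W V _ _ z = trans (Σ<-zero N W λ i → z i z≤n) (sym (ℚP.*-zeroˡ V))
Σ<-indicator (suc x) (suc N) W V (s≤s x≤N) e z = trans
  (cong₂ _+_ (e 0 (s≤s z≤n)) (Σ<-indicator x N (W ∘ suc) V x≤N (λ i p → e (suc i) (s≤s p)) (λ i p → z (suc i) (s≤s p))))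
  (lem V (ι x))
  where
  lem : ∀ v y → v + y * v ≡ (1ℚ + y) * v
  lem = solve 2 (λ v y → v :+ y :* v := (con 1ℚ :+ y) :* v) refl

-- Newton's identity Σ p_i h_{m-i} = m h_m for m = n - k, the factor m being read off as the degree
-- of α. The offset `k` absorbs the exponents of variables already peeled off.
newton : ∀ α N k n → size α ≤ N → Σ< N (λ i → (P (suc i) ⊛ hd (k ℕ.+ suc i) n) α) ≡ ι (size α) * hd k n α
newton [] N k n _ = trans (Σ<-zero N _ λ i → ℚP.*-zeroˡ (hd (k ℕ.+ suc i) n [])) (sym (ℚP.*-zeroˡ (hd k n [])))
newton (x ∷ α) N k n le = begin
  Σ< N (λ i → (P (suc i) ⊛ hd (k ℕ.+ suc i) n) (x ∷ α))
    ≡⟨ Σ<-cong N (λ i _ → term i) ⟩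
  Σ< N (λ i → W i + (P (suc i) ⊛ hd (k ℕ.+ x ℕ.+ suc i) n) α)
    ≡⟨ Σ<-+ N W _ ⟩
  Σ< N W + Σ< N (λ i → (P (suc i) ⊛ hd (k ℕ.+ x ℕ.+ suc i) n) α)
    -- Either x₁^(i+1) is taken from p_{i+1}, which is possible for exactly the x indices i < x, or
    -- p_{i+1} uses the other variables and x₁^x comes from the homogeneous factor.
    ≡⟨ cong₂ _+_ (Σ<-indicator x N W V (ℕP.m+n≤o⇒m≤o x le) W-low W-high) (newton α N (k ℕ.+ x) n (ℕP.m+n≤o⇒n≤o x le)) ⟩
  ι x * V + ι (size α) * V
    ≡⟨ ℚP.*-distribʳ-+ V (ι x) (ι (size α)) ⟨
  (ι x + ι (size α)) * V
    ≡⟨ cong₂ _*_ (ι-+ x (size α)) (hd-∷ k n x α) ⟨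
  ι (x ℕ.+ size α) * hd k n (x ∷ α) ∎
  where
  V : ℚ
  V = hd (k ℕ.+ x) n α

  W : ℕ → ℚ
  W i = conv x (λ b c → ind (b ≡ᵇ suc i) * hd (k ℕ.+ suc i ℕ.+ c) n α)

  W-low : ∀ i → i < x → W i ≡ V
  W-low i i<x with ℕP.m≤n⇒∃[o]m+o≡n i<x
  ... | (j , refl) = trans (conv-ind (suc i) j (λ c → hd (k ℕ.+ suc i ℕ.+ c) n α))
    (cong (λ m → hd m n α) (ℕP.+-assoc k (suc i) j))

  W-high : ∀ i → x ≤ i → W i ≡ 0ℚ
  W-high i x≤i = conv-ind-zero x (suc i) (λ c → hd (k ℕ.+ suc i ℕ.+ c) n α) (s≤s x≤i)

  swap : ∀ a b c → a ℕ.+ b ℕ.+ c ≡ a ℕ.+ c ℕ.+ b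
  swap a b c = trans (ℕP.+-assoc a b c) (trans (cong (a ℕ.+_) (ℕP.+-comm b c)) (sym (ℕP.+-assoc a c b)))

  term : ∀ i → (P (suc i) ⊛ hd (k ℕ.+ suc i) n) (x ∷ α) ≡ W i + (P (suc i) ⊛ hd (k ℕ.+ x ℕ.+ suc i) n) α
  term i = begin
    (P (suc i) ⊛ H) (x ∷ α)
      ≡⟨ conv-cong x (λ b c _ → split b c) ⟩
    conv x (λ b c → ind (b ≡ᵇ suc i) * H' c α + ind (b ≡ᵇ 0) * (P (suc i) ⊛ H' c) α)
      ≡⟨ conv-+ x (λ b c → ind (b ≡ᵇ suc i) * H' c α) (λ b c → ind (b ≡ᵇ 0) * (P (suc i) ⊛ H' c) α) ⟩
    W i + conv x (λ b c → ind (b ≡ᵇ 0) * (P (suc i) ⊛ H' c) α)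
      ≡⟨ cong (W i +_) (conv-ind 0 x (λ c → (P (suc i) ⊛ H' c) α)) ⟩
    W i + (P (suc i) ⊛ H' x) α
      ≡⟨ cong (λ m → W i + (P (suc i) ⊛ hd m n) α) (swap k (suc i) x) ⟩
    W i + (P (suc i) ⊛ hd (k ℕ.+ x ℕ.+ suc i) n) α ∎
    where
    H : Series
    H = hd (k ℕ.+ suc i) n

    H' : ℕ → Series
    H' c = hd (k ℕ.+ suc i ℕ.+ c) n

    split : ∀ b c → ((P (suc i) ∘ (b ∷_)) ⊛ (H ∘ (c ∷_))) α ≡
      ind (b ≡ᵇ suc i) * H' c α + ind (b ≡ᵇ 0) * (P (suc i) ⊛ H' c) α
    split b c = begin
      ((P (suc i) ∘ (b ∷_)) ⊛ (H ∘ (c ∷_))) α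
        ≡⟨ ⊛-cong (P-∷ (suc i) b) (hd-∷ (k ℕ.+ suc i) n c) α ⟩
      (((ind (b ≡ᵇ suc i) ⊙ hS 0) ⊕ (ind (b ≡ᵇ 0) ⊙ P (suc i))) ⊛ H' c) α
        ≡⟨ L .add (ind (b ≡ᵇ suc i) ⊙ hS 0) (ind (b ≡ᵇ 0) ⊙ P (suc i)) ⟩
      ((ind (b ≡ᵇ suc i) ⊙ hS 0) ⊛ H' c) α + ((ind (b ≡ᵇ 0) ⊙ P (suc i)) ⊛ H' c) α
        ≡⟨ cong₂ _+_ (L .scale (ind (b ≡ᵇ suc i)) (hS 0)) (L .scale (ind (b ≡ᵇ 0)) (P (suc i))) ⟩
      ind (b ≡ᵇ suc i) * (hS 0 ⊛ H' c) α + ind (b ≡ᵇ 0) * (P (suc i) ⊛ H' c) α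
        ≡⟨ cong (λ h → ind (b ≡ᵇ suc i) * h + ind (b ≡ᵇ 0) * (P (suc i) ⊛ H' c) α) (hS0-unitˡ (H' c) α) ⟩
      ind (b ≡ᵇ suc i) * H' c α + ind (b ≡ᵇ 0) * (P (suc i) ⊛ H' c) α ∎
      where
      L = ⊛-linearˡ (H' c) α

degree-hS : ∀ n α → ι (size α) * hS n α ≡ ι n * hS n α
degree-hS n α with size α ℕ.≟ n
... | yes e = cong (λ m → ι m * hS n α) e
... | no ne with size α ≡ᵇ n in eq
...   | true = ⊥-elim (ne (ℕP.≡ᵇ⇒≡ _ _ (subst T (sym eq) _)))
...   | false = trans (ℚP.*-zeroʳ (ι (size α))) (sym (ℚP.*-zeroʳ (ι n)))

-- In Newton's identity the term i = m carries h_0 and later terms carry h of negative degree, so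
-- p_{m+1} is expressed through smaller power sums.
P-newton : ∀ m α → ι (suc m) * hS (suc m) α ≡ P (suc m) α + Σ< m (λ i → (P (suc i) ⊛ hd (suc i) (suc m)) α)
P-newton m α = begin
  ι (suc m) * hS (suc m) α
    ≡⟨ degree-hS (suc m) α ⟨
  ι (size α) * hS (suc m) α
    -- This bound is at least the degree of α, as `newton` requires, and can be split at `suc m`.
    ≡⟨ newton α (suc m ℕ.+ size α) 0 (suc m) (ℕP.m≤n+m (size α) (suc m)) ⟨
  Σ< (suc m ℕ.+ size α) F
    ≡⟨ Σ<-split (suc m) (size α) F ⟩
  Σ< (suc m) F + Σ< (size α) (λ i → F (suc m ℕ.+ i))
    ≡⟨ cong₂ _+_ (Σ<-last m F) (Σ<-zero (size α) (λ i → F (suc m ℕ.+ i)) tail-zero) ⟩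
  (Σ< m F + F m) + 0ℚ
    ≡⟨ ℚP.+-identityʳ _ ⟩
  Σ< m F + F m
    ≡⟨ ℚP.+-comm (Σ< m F) (F m) ⟩
  F m + Σ< m F
    ≡⟨ cong (_+ Σ< m F) top ⟩
  P (suc m) α + Σ< m F ∎
  where
  F : ℕ → ℚ
  F i = (P (suc i) ⊛ hd (suc i) (suc m)) α

  tail-zero : ∀ i → F (suc m ℕ.+ i) ≡ 0ℚ
  tail-zero i = zero-at (⊛-linearʳ (P (suc (suc m ℕ.+ i))) α)
    (hd-zero (suc (suc m ℕ.+ i)) (suc m) (s≤s (ℕP.m≤m+n (suc m) i)))

  top : F m ≡ P (suc m) α
  top = trans (⊛-linearʳ (P (suc m)) α .ext (sym ∘ hS-as-hd (ℕP.+-identityʳ (suc m)))) (hS0-unitʳ (P (suc m)) α)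

Span-P : ∀ m → Span (P (suc m))
Span-P = <-rec (λ m → Span (P (suc m))) λ m rec → Span-⊖ (ι (suc m) ⊙ˢ Span-hS (suc m))
  (Span-Σ< m λ i i<m → Span-⊛ (rec i<m) (Span-hd (suc i) (suc m))) (P-newton m)

-- The recursion `C-hd-⊛` raises the index of `C`, so the induction on τ treats all a at once; at a
-- positive index the base case is a power sum.
Span-C-hProd : ∀ a τ → Span (C (suc a) (hProd τ))
Span-C-hProd a [] = Span-P a
Span-C-hProd a (r ∷ τ) = respˢ (λ α → C-linear (suc a) α .ext (sym ∘ hProd-∷ r τ))
  (Span-⊖ (Span-⊛ (Span-hd 0 r) (Span-C-hProd a τ)) (Span-⊛ (Span-hd 1 r) (Span-C-hProd (suc a) τ))
    (C-hd-⊛ (suc a) 0 r (hProd τ)))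

Span-C : ∀ {S} a → Span S → Span (C (suc a) S)
Span-C a (hprod τ) = Span-C-hProd a τ
Span-C a (_⊕ˢ_ {S} {U} s u) = respˢ (λ α → sym (C-linear (suc a) α .add S U)) (Span-C a s ⊕ˢ Span-C a u)
Span-C a (_⊙ˢ_ c {S} s) = respˢ (λ α → sym (C-linear (suc a) α .scale c S)) (c ⊙ˢ Span-C a s)
Span-C a (respˢ e s) = respˢ (λ α → C-linear (suc a) α .ext e) (Span-C a s)

-- Monomial series

insertDesc-≤ : ∀ {x y} ys → y ≤ x → insertDesc x (y ∷ ys) ≡ x ∷ y ∷ ys
insertDesc-≤ {x} {y} ys y≤x with y ≤ᵇ x in eq
... | true = refl
... | false = ⊥-elim (subst T eq (ℕP.≤⇒≤ᵇ y≤x))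

insertDesc-> : ∀ {x y} ys → x < y → insertDesc x (y ∷ ys) ≡ y ∷ insertDesc x ys
insertDesc-> {x} {y} ys x<y with y ≤ᵇ x in eq
... | true = ⊥-elim (ℕP.<⇒≱ x<y (ℕP.≤ᵇ⇒≤ y x (subst T (sym eq) _)))
... | false = refl

insertDesc-comm-< : ∀ {x y} l → y < x → insertDesc x (insertDesc y l) ≡ insertDesc y (insertDesc x l)
insertDesc-comm-< [] y<x = trans (insertDesc-≤ [] (ℕP.<⇒≤ y<x)) (sym (insertDesc-> [] y<x))
insertDesc-comm-< {x} {y} (z ∷ zs) y<x with ℕP.≤-<-connex z y | ℕP.≤-<-connex z x
... | inj₁ z≤y | inj₂ x<z = ⊥-elim (ℕP.<-asym y<x (ℕP.<-≤-trans x<z z≤y))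
... | inj₁ z≤y | inj₁ z≤x = begin
  insertDesc x (insertDesc y (z ∷ zs)) ≡⟨ cong (insertDesc x) (insertDesc-≤ zs z≤y) ⟩
  insertDesc x (y ∷ z ∷ zs)            ≡⟨ insertDesc-≤ (z ∷ zs) (ℕP.<⇒≤ y<x) ⟩
  x ∷ y ∷ z ∷ zs                       ≡⟨ cong (x ∷_) (insertDesc-≤ zs z≤y) ⟨
  x ∷ insertDesc y (z ∷ zs)            ≡⟨ insertDesc-> (z ∷ zs) y<x ⟨
  insertDesc y (x ∷ z ∷ zs)            ≡⟨ cong (insertDesc y) (insertDesc-≤ zs z≤x) ⟨
  insertDesc y (insertDesc x (z ∷ zs)) ∎
... | inj₂ y<z | inj₁ z≤x = begin
  insertDesc x (insertDesc y (z ∷ zs)) ≡⟨ cong (insertDesc x) (insertDesc-> zs y<z) ⟩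
  insertDesc x (z ∷ insertDesc y zs)   ≡⟨ insertDesc-≤ (insertDesc y zs) z≤x ⟩
  x ∷ z ∷ insertDesc y zs              ≡⟨ cong (x ∷_) (insertDesc-> zs y<z) ⟨
  x ∷ insertDesc y (z ∷ zs)            ≡⟨ insertDesc-> (z ∷ zs) y<x ⟨
  insertDesc y (x ∷ z ∷ zs)            ≡⟨ cong (insertDesc y) (insertDesc-≤ zs z≤x) ⟨
  insertDesc y (insertDesc x (z ∷ zs)) ∎
... | inj₂ y<z | inj₂ x<z = begin
  insertDesc x (insertDesc y (z ∷ zs)) ≡⟨ cong (insertDesc x) (insertDesc-> zs y<z) ⟩
  insertDesc x (z ∷ insertDesc y zs)   ≡⟨ insertDesc-> (insertDesc y zs) x<z ⟩
  z ∷ insertDesc x (insertDesc y zs)   ≡⟨ cong (z ∷_) (insertDesc-comm-< zs y<x) ⟩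
  z ∷ insertDesc y (insertDesc x zs)   ≡⟨ insertDesc-> (insertDesc x zs) y<z ⟨
  insertDesc y (z ∷ insertDesc x zs)   ≡⟨ cong (insertDesc y) (insertDesc-> zs x<z) ⟨
  insertDesc y (insertDesc x (z ∷ zs)) ∎

insertDesc-comm : ∀ x y l → insertDesc x (insertDesc y l) ≡ insertDesc y (insertDesc x l)
insertDesc-comm x y l with ℕP.<-cmp x y
... | tri< x<y _ _ = sym (insertDesc-comm-< l x<y)
... | tri≈ _ refl _ = refl
... | tri> _ _ y<x = insertDesc-comm-< l y<x

-- A left inverse of `insertDesc a`, introduced to prove that insertion is injective.
removeFirst : ℕ → List ℕ → List ℕ
removeFirst a [] = []
removeFirst a (y ∷ ys) with a ℕ.≟ y
... | yes _ = ys
... | no _ = y ∷ removeFirst a ys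

removeFirst-≡ : ∀ a ys → removeFirst a (a ∷ ys) ≡ ys
removeFirst-≡ a ys with a ℕ.≟ a
... | yes _ = refl
... | no a≢a = ⊥-elim (a≢a refl)

removeFirst-≢ : ∀ {a y ys} → a ≢ y → removeFirst a (y ∷ ys) ≡ y ∷ removeFirst a ys
removeFirst-≢ {a} {y} a≢y with a ℕ.≟ y
... | yes a≡y = ⊥-elim (a≢y a≡y)
... | no _ = refl

removeFirst-insertDesc : ∀ a l → removeFirst a (insertDesc a l) ≡ l
removeFirst-insertDesc a [] = removeFirst-≡ a []
removeFirst-insertDesc a (y ∷ ys) with ℕP.≤-<-connex y a
... | inj₁ y≤a = trans (cong (removeFirst a) (insertDesc-≤ ys y≤a)) (removeFirst-≡ a (y ∷ ys))
... | inj₂ a<y = trans (cong (removeFirst a) (insertDesc-> ys a<y))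
  (trans (removeFirst-≢ (ℕP.<⇒≢ a<y)) (cong (y ∷_) (removeFirst-insertDesc a ys)))

insertDesc-injective : ∀ a l m → insertDesc a l ≡ insertDesc a m → l ≡ m
insertDesc-injective a l m e = begin
  l                              ≡⟨ removeFirst-insertDesc a l ⟨
  removeFirst a (insertDesc a l) ≡⟨ cong (removeFirst a) e ⟩
  removeFirst a (insertDesc a m) ≡⟨ removeFirst-insertDesc a m ⟩
  m                              ∎

insertDesc-≢[] : ∀ x l → insertDesc x l ≢ []
insertDesc-≢[] x (y ∷ ys) e with y ≤ᵇ x
insertDesc-≢[] x (y ∷ ys) () | true
insertDesc-≢[] x (y ∷ ys) () | false

-- Used to rule out exponents above 1 in e_i.
insertDesc-head : ∀ {x l y ys} → insertDesc x l ≡ y ∷ ys → x ≤ y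
insertDesc-head {x} {[]} refl = ℕP.≤-refl
insertDesc-head {x} {z ∷ zs} e with ℕP.≤-<-connex z x
... | inj₁ z≤x = ℕP.≤-reflexive (LP.∷-injectiveˡ (trans (sym (insertDesc-≤ zs z≤x)) e))
... | inj₂ x<z = ℕP.<⇒≤ (subst (x <_) (LP.∷-injectiveˡ (trans (sym (insertDesc-> zs x<z)) e)) x<z)

normalize-drop : ∀ β γ → normalize (β ++ 0 ∷ γ) ≡ normalize (β ++ γ)
normalize-drop [] γ = refl
normalize-drop (zero ∷ β) γ = normalize-drop β γ
normalize-drop (suc x ∷ β) γ = cong (insertDesc (suc x)) (normalize-drop β γ)

normalize-pull : ∀ β a γ → normalize (β ++ suc a ∷ γ) ≡ insertDesc (suc a) (normalize (β ++ γ))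
normalize-pull [] a γ = refl
normalize-pull (zero ∷ β) a γ = normalize-pull β a γ
normalize-pull (suc x ∷ β) a γ = trans (cong (insertDesc (suc x)) (normalize-pull β a γ))
  (insertDesc-comm (suc x) (suc a) (normalize (β ++ γ)))

partition-head-positive : ∀ {x xs} → IsPartition (x ∷ xs) → 0 < x
partition-head-positive (one 0<x) = 0<x
partition-head-positive (cons y≤x p) = ℕP.<-≤-trans (partition-head-positive p) y≤x

normalize-∷ : ∀ {x} xs → 0 < x → normalize (x ∷ xs) ≡ insertDesc x (normalize xs)
normalize-∷ {suc x} xs _ = refl

normalize-partition : ∀ {μ} → IsPartition μ → normalize μ ≡ μ
normalize-partition nil = refl
normalize-partition (one 0<x) = normalize-∷ [] 0<x
normalize-partition p@(cons {x} {y} {ys} y≤x q) = begin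
  normalize (x ∷ y ∷ ys)            ≡⟨ normalize-∷ (y ∷ ys) (partition-head-positive p) ⟩
  insertDesc x (normalize (y ∷ ys)) ≡⟨ cong (insertDesc x) (normalize-partition q) ⟩
  insertDesc x (y ∷ ys)             ≡⟨ insertDesc-≤ ys y≤x ⟩
  x ∷ y ∷ ys                        ∎

mS-yes : ∀ {μ α} → normalize α ≡ μ → mS μ α ≡ 1ℚ
mS-yes {μ} {α} e = cong ind (dec-true (LP.≡-dec ℕ._≟_ (normalize α) μ) e)

mS-no : ∀ {μ α} → normalize α ≢ μ → mS μ α ≡ 0ℚ
mS-no {μ} {α} e = cong ind (dec-false (LP.≡-dec ℕ._≟_ (normalize α) μ) e)

mS-⇔ : ∀ {μ ν α β} → (normalize α ≡ μ → normalize β ≡ ν) → (normalize β ≡ ν → normalize α ≡ μ) → mS μ α ≡ mS ν β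
mS-⇔ {μ} {ν} {α} {β} f g with LP.≡-dec ℕ._≟_ (normalize α) μ
... | yes e = sym (mS-yes {ν} {β} (f e))
... | no ne = sym (mS-no {ν} {β} (ne ∘ g))

-- Off the support of m_μ both sides vanish. This trades a count on α for the count on μ.
mS-weight : ∀ {μ α} m n → (normalize α ≡ μ → m ≡ n) → m * mS μ α ≡ n * mS μ α
mS-weight {μ} {α} m n f with LP.≡-dec ℕ._≟_ (normalize α) μ
... | yes e = cong (_* 1ℚ) (f e)
... | no _ = trans (ℚP.*-zeroʳ m) (sym (ℚP.*-zeroʳ n))

size-normalize-[] : ∀ α → normalize α ≡ [] → size α ≡ 0
size-normalize-[] [] _ = refl
size-normalize-[] (zero ∷ α) e = size-normalize-[] α e
size-normalize-[] (suc x ∷ α) e = ⊥-elim (insertDesc-≢[] (suc x) (normalize α) e)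

mS-[] : mS [] ≗ hS 0
mS-[] [] = refl
mS-[] (zero ∷ α) = mS-[] α
mS-[] (suc x ∷ α) = mS-no {[]} {suc x ∷ α} (insertDesc-≢[] (suc x) (normalize α))

-- Multiplicities of parts.

count : ℕ → List ℕ → ℕ
count a [] = 0
count a (x ∷ xs) = if x ≡ᵇ a then suc (count a xs) else count a xs

count-∷-cong : ∀ a x {l m} → count a l ≡ count a m → count a (x ∷ l) ≡ count a (x ∷ m)
count-∷-cong a x e with x ≡ᵇ a
... | true = cong suc e
... | false = e

count-swap : ∀ a x y l → count a (x ∷ y ∷ l) ≡ count a (y ∷ x ∷ l)
count-swap a x y l with x ≡ᵇ a | y ≡ᵇ a
... | true | true = refl
... | true | false = refl
... | false | true = refl
... | false | false = refl

count-insertDesc : ∀ a x l → count a (insertDesc x l) ≡ count a (x ∷ l)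
count-insertDesc a x [] = refl
count-insertDesc a x (y ∷ ys) with y ≤ᵇ x
... | true = refl
... | false = trans (count-∷-cong a y {insertDesc x ys} {x ∷ ys} (count-insertDesc a x ys)) (count-swap a y x ys)

count-normalize : ∀ a α → count (suc a) (normalize α) ≡ count (suc a) α
count-normalize a [] = refl
count-normalize a (zero ∷ α) = count-normalize a α
count-normalize a (suc x ∷ α) = trans (count-insertDesc (suc a) (suc x) (normalize α))
  (count-∷-cong (suc a) (suc x) {normalize α} {α} (count-normalize a α))

≡ᵇ-refl : ∀ n → (n ≡ᵇ n) ≡ true
≡ᵇ-refl zero = refl
≡ᵇ-refl (suc n) = ≡ᵇ-refl n

count-≡ : ∀ a l → count a (a ∷ l) ≡ suc (count a l)
count-≡ a l rewrite ≡ᵇ-refl a = refl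

count-replicate : ∀ a j α → count a (replicate j a ++ α) ≡ j ℕ.+ count a α
count-replicate a zero α = refl
count-replicate a (suc j) α = trans (count-≡ a (replicate j a ++ α)) (cong suc (count-replicate a j α))

-- Every counted entry is positive and so adds at least 1 to the size. In the theorem this shows
-- that truncating at the degree of α loses nothing.
count-≤-size : ∀ a α → count (suc a) α ≤ size α
count-≤-size a [] = z≤n
count-≤-size a (x ∷ α) with x ≡ᵇ suc a in eq
count-≤-size a (suc x ∷ α) | true = s≤s (ℕP.≤-trans (count-≤-size a α) (ℕP.m≤n+m (size α) x))
count-≤-size a (x ∷ α) | false = ℕP.≤-trans (count-≤-size a α) (ℕP.m≤n+m (size α) x)

-- Each position of α holding a contributes the coefficient of `S` with that entry set to 0, which
-- the hypothesis identifies with the coefficient of `U` at α.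
C-replace : ∀ a S U → (∀ β γ → S (β ++ 0 ∷ γ) ≡ U (β ++ a ∷ γ)) → ∀ α → C a S α ≡ ι (count a α) * U α
C-replace a S U e [] = sym (ℚP.*-zeroˡ (U []))
C-replace a S U e (x ∷ α) = trans
  (cong (ind (x ≡ᵇ a) * S (0 ∷ α) +_) (C-replace a (S ∘ (x ∷_)) (U ∘ (x ∷_)) (e ∘ (x ∷_)) α)) lem
  where
  arith : ∀ u n → 1ℚ * u + n * u ≡ (1ℚ + n) * u
  arith = solve 2 (λ u n → con 1ℚ :* u :+ n :* u := (con 1ℚ :+ n) :* u) refl

  lem : ind (x ≡ᵇ a) * S (0 ∷ α) + ι (count a α) * U (x ∷ α) ≡ ι (count a (x ∷ α)) * U (x ∷ α)
  lem with x ≡ᵇ a in eq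
  ... | true rewrite ℕP.≡ᵇ⇒≡ x a (subst T (sym eq) _) =
    trans (cong (λ s → 1ℚ * s + ι (count a α) * U (a ∷ α)) (e [] α)) (arith (U (a ∷ α)) (ι (count a α)))
  ... | false = trans (cong (_+ ι (count a α) * U (x ∷ α)) (ℚP.*-zeroˡ (S (0 ∷ α)))) (ℚP.+-identityˡ _)

-- Zeroing any entry `suc a` of a vector of shape `insertDesc (suc a) μ` leaves the shape μ, and
-- such a vector has one more of these entries than μ has.
C-mS : ∀ a μ → C (suc a) (mS μ) ≗ ι (suc (count (suc a) μ)) ⊙ mS (insertDesc (suc a) μ)
C-mS a μ α = trans (C-replace (suc a) (mS μ) (mS (insertDesc (suc a) μ)) replace α)
  (mS-weight {insertDesc (suc a) μ} {α} (ι (count (suc a) α)) (ι (suc (count (suc a) μ))) λ e → cong ι (begin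
    count (suc a) α                        ≡⟨ count-normalize a α ⟨
    count (suc a) (normalize α)            ≡⟨ cong (count (suc a)) e ⟩
    count (suc a) (insertDesc (suc a) μ)   ≡⟨ count-insertDesc (suc a) (suc a) μ ⟩
    count (suc a) (suc a ∷ μ)              ≡⟨ count-≡ (suc a) μ ⟩
    suc (count (suc a) μ)                  ∎))
  where
  replace : ∀ β γ → mS μ (β ++ 0 ∷ γ) ≡ mS (insertDesc (suc a) μ) (β ++ suc a ∷ γ)
  replace β γ = mS-⇔ {μ} {insertDesc (suc a) μ} {β ++ 0 ∷ γ} {β ++ suc a ∷ γ}
    (λ e → trans (normalize-pull β a γ) (cong (insertDesc (suc a)) (trans (sym (normalize-drop β γ)) e)))
    (λ e → trans (normalize-drop β γ) (insertDesc-injective (suc a) _ _ (trans (sym (normalize-pull β a γ)) e)))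

P-mS : ∀ a → P (suc a) ≗ mS (suc a ∷ [])
P-mS a α = begin
  C (suc a) (hS 0) α          ≡⟨ C-linear (suc a) α .ext mS-[] ⟨
  C (suc a) (mS []) α         ≡⟨ C-mS a [] α ⟩
  1ℚ * mS (suc a ∷ []) α      ≡⟨ ℚP.*-identityˡ _ ⟩
  mS (suc a ∷ []) α           ∎

-- RM_a^{(1)} on the span of the h_τ

replicate-insertDesc : ∀ i → insertDesc 1 (replicate i 1) ≡ replicate (suc i) 1
replicate-insertDesc zero = refl
replicate-insertDesc (suc i) = refl

eS-zero : ∀ x → eS 0 ∘ (suc x ∷_) ≗ 𝟘
eS-zero x α = mS-no {[]} {suc x ∷ α} (insertDesc-≢[] (suc x) (normalize α))

-- e_{i+1} is squarefree, so only the exponent 1 of x₁ survives and leaves e_i in the other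
-- variables.
eS-suc : ∀ i x → eS (suc i) ∘ (suc x ∷_) ≗ ind (x ≡ᵇ 0) ⊙ eS i
eS-suc i zero α = trans
  (mS-⇔ {replicate (suc i) 1} {replicate i 1} {1 ∷ α} {α}
    (λ e → insertDesc-injective 1 _ _ (trans e (sym (replicate-insertDesc i))))
    (λ e → trans (cong (insertDesc 1) e) (replicate-insertDesc i)))
  (sym (ℚP.*-identityˡ _))
eS-suc i (suc x) α = trans
  (mS-no {replicate (suc i) 1} {suc (suc x) ∷ α} λ e →
    ℕP.<⇒≱ (s≤s (s≤s z≤n)) (insertDesc-head {l = normalize α} e))
  (sym (ℚP.*-zeroˡ (eS i α)))

-- E i τ is e_i^⊥ h_τ.
E : ℕ → List ℕ → Series
E zero [] = hS 0
E (suc i) [] = 𝟘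
E zero (r ∷ τ) = hS r ⊛ E zero τ
E (suc i) (r ∷ τ) = (hS r ⊛ E (suc i) τ) ⊕ (hd 1 r ⊛ E i τ)

-- By `hProd-sym` the left side is the coefficient of x^τ in e_i h_β, that is ⟨h_τ, e_i h_β⟩. As e_i
-- takes exponent 0 or 1 from each variable, peeling off a part r of τ yields the two summands of
-- `E`.
eS-⊛-hProd : ∀ i τ β → (eS i ⊛ (λ σ → hProd σ β)) τ ≡ E i τ β
eS-⊛-hProd zero [] β = ℚP.*-identityˡ _
eS-⊛-hProd (suc i) [] β = ℚP.*-zeroˡ (hProd [] β)
eS-⊛-hProd i (r ∷ τ) β = go i r
  where
  U : ℕ → Series
  U j σ = hProd (j ∷ σ) β

  step : ∀ i j → (eS i ⊛ U j) τ ≡ (hS j ⊛ E i τ) β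
  step i j = begin
    (eS i ⊛ U j) τ
      ≡⟨ ⊛-linearʳ (eS i) τ .ext (λ σ → hProd-∷ j σ β) ⟩
    (eS i ⊛ (λ σ → (hS j ⊛ hProd σ) β)) τ
      ≡⟨ ⊛-out (⊛-linearʳ (hS j) β) (eS i) hProd τ ⟨
    (hS j ⊛ (λ γ → (eS i ⊛ (λ σ → hProd σ γ)) τ)) β
      ≡⟨ ⊛-linearʳ (hS j) β .ext (eS-⊛-hProd i τ) ⟩
    (hS j ⊛ E i τ) β ∎

  go : ∀ i r → (eS i ⊛ (λ σ → hProd σ β)) (r ∷ τ) ≡ E i (r ∷ τ) β
  go zero zero = step 0 0
  go (suc i) zero = trans (step (suc i) 0)
    (sym (trans (cong ((hS 0 ⊛ E (suc i) τ) β +_) (hd-⊛-zero 1 0 (E i τ) (s≤s z≤n) β)) (ℚP.+-identityʳ _)))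
  go zero (suc r) = trans (cong₂ _+_ (step 0 (suc r))
      (conv-zero r _ λ p q _ → zero-at (⊛-linearˡ (U q) τ) (eS-zero p)))
    (ℚP.+-identityʳ _)
  go (suc i) (suc r) = cong₂ _+_ (step (suc i) (suc r)) (begin
    conv r (λ p q → ((eS (suc i) ∘ (suc p ∷_)) ⊛ U q) τ)
      ≡⟨ conv-cong r (λ p q _ → trans (⊛-linearˡ (U q) τ .ext (eS-suc i p)) (⊛-linearˡ (U q) τ .scale (ind (p ≡ᵇ 0)) (eS i))) ⟩
    conv r (λ p q → ind (p ≡ᵇ 0) * (eS i ⊛ U q) τ)
      ≡⟨ conv-ind 0 r (λ q → (eS i ⊛ U q) τ) ⟩
    (eS i ⊛ U r) τ
      ≡⟨ step i r ⟩
    (hS r ⊛ E i τ) β ∎)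

-- By `hProd-sym`, pairing h_τ with h_μ h_ν takes the coefficient of x^τ in that product. Hence the
-- pairing depends on `g` only through its series.
hall-mulH : ∀ τ g ν → hall (hProd τ) (mulH g ν) ≡ (toSeries g ⊛ hProd ν) τ
hall-mulH τ [] ν = sym (zero-at (⊛-linearˡ (hProd ν) τ) λ _ → refl)
hall-mulH τ ((c , μ) ∷ g) ν = begin
  c * hProd τ (normalize (μ ++ ν)) + hall (hProd τ) (mulH g ν)
    ≡⟨ cong₂ _+_ (cong (c *_) pair) (hall-mulH τ g ν) ⟩
  c * (hProd μ ⊛ hProd ν) τ + (toSeries g ⊛ hProd ν) τ
    ≡⟨ cong (_+ (toSeries g ⊛ hProd ν) τ) (⊛-linearˡ (hProd ν) τ .scale c (hProd μ)) ⟨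
  ((c ⊙ hProd μ) ⊛ hProd ν) τ + (toSeries g ⊛ hProd ν) τ
    ≡⟨ ⊛-linearˡ (hProd ν) τ .add (c ⊙ hProd μ) (toSeries g) ⟨
  (toSeries ((c , μ) ∷ g) ⊛ hProd ν) τ ∎
  where
  pair : hProd τ (normalize (μ ++ ν)) ≡ (hProd μ ⊛ hProd ν) τ
  pair = begin
    hProd τ (normalize (μ ++ ν)) ≡⟨ hProd-normalize τ (μ ++ ν) ⟩
    hProd τ (μ ++ ν)             ≡⟨ hProd-sym (μ ++ ν) τ ⟩
    hProd (μ ++ ν) τ             ≡⟨ hProd-++ μ ν τ ⟩
    (hProd μ ⊛ hProd ν) τ        ∎

perp-hProd : ∀ g i → toSeries g ≗ eS i → ∀ τ → perp g (hProd τ) ≗ E i τ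
perp-hProd g i e τ α = begin
  hall (hProd τ) (mulH g (normalize α))  ≡⟨ hall-mulH τ g (normalize α) ⟩
  (toSeries g ⊛ hProd (normalize α)) τ   ≡⟨ ⊛-cong e (λ σ → trans (hProd-normalizeˡ α σ) (sym (hProd-sym α σ))) τ ⟩
  (eS i ⊛ (λ σ → hProd σ α)) τ           ≡⟨ eS-⊛-hProd i τ α ⟩
  E i τ α                                ∎

-- Comparison of the truncated sums with C_a.

C-degree : ∀ a S α → size α < a → C a S α ≡ 0ℚ
C-degree a S [] _ = refl
C-degree a S (x ∷ α) p = trans (cong₂ _+_
    (trans (cong (λ b → ind b * S (0 ∷ α)) (x≢a (x ≡ᵇ a) refl)) (ℚP.*-zeroˡ (S (0 ∷ α))))
    (C-degree a (S ∘ (x ∷_)) α (ℕP.≤-<-trans (ℕP.m≤n+m (size α) x) p)))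
  refl
  where
  x≢a : ∀ b → (x ≡ᵇ a) ≡ b → (x ≡ᵇ a) ≡ false
  x≢a false e = e
  x≢a true e with refl ← ℕP.≡ᵇ⇒≡ x a (subst T (sym e) _) = ⊥-elim (ℕP.<⇒≱ p (ℕP.m≤m+n x (size α)))

-- The bound n is independent of α, which makes this one series that can be multiplied by others.
partialRM1 : ℕ → ℕ → List ℕ → Series
partialRM1 a n τ α = Σ< n (λ i → sgn i * (P (a ℕ.+ i) ⊛ E i τ) α)

⊛-partialRM1 : ∀ A a n τ α → Σ< n (λ i → sgn i * (P (a ℕ.+ i) ⊛ (A ⊛ E i τ)) α) ≡ (A ⊛ partialRM1 a n τ) α
⊛-partialRM1 A a n τ α = begin
  Σ< n (λ i → sgn i * (P (a ℕ.+ i) ⊛ (A ⊛ E i τ)) α)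
    ≡⟨ Σ<-cong n (λ i _ → trans (cong (sgn i *_) (⊛-swap (P (a ℕ.+ i)) A (E i τ) α))
         (sym (⊛-linearʳ A α .scale (sgn i) (P (a ℕ.+ i) ⊛ E i τ)))) ⟩
  Σ< n (λ i → (A ⊛ (sgn i ⊙ (P (a ℕ.+ i) ⊛ E i τ))) α)
    ≡⟨ Σ<-out (⊛-linearʳ A α) n (λ i → sgn i ⊙ (P (a ℕ.+ i) ⊛ E i τ)) ⟨
  (A ⊛ partialRM1 a n τ) α ∎

-- In the first summand of `E`, h_r factors out; in the second, the index shift flips the sign and
-- moves a 1 into a. The result has the form of `C-hd-⊛` solved for `C a` of the product.
partialRM1-∷ : ∀ a n r τ α →
  partialRM1 a (suc n) (r ∷ τ) α ≡ (hS r ⊛ partialRM1 a (suc n) τ) α + (- 1ℚ) * (hd 1 r ⊛ partialRM1 (suc a) n τ) α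
partialRM1-∷ a n r τ α = begin
  u 0 + Σ< n (λ i → sgn (suc i) * (P (a ℕ.+ suc i) ⊛ E (suc i) (r ∷ τ)) α)
    ≡⟨ cong (u 0 +_) (Σ<-cong n (λ i _ → term i)) ⟩
  u 0 + Σ< n (λ i → u (suc i) + (- 1ℚ) * v i)
    ≡⟨ cong (u 0 +_) (Σ<-+ n (u ∘ suc) (λ i → (- 1ℚ) * v i)) ⟩
  u 0 + (Σ< n (u ∘ suc) + Σ< n (λ i → (- 1ℚ) * v i))
    ≡⟨ ℚP.+-assoc (u 0) _ _ ⟨
  Σ< (suc n) u + Σ< n (λ i → (- 1ℚ) * v i)
    ≡⟨ cong₂ _+_ (⊛-partialRM1 (hS r) a (suc n) τ α)
         (trans (Σ<-* n (- 1ℚ) v) (cong ((- 1ℚ) *_) (⊛-partialRM1 (hd 1 r) (suc a) n τ α))) ⟩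
  (hS r ⊛ partialRM1 a (suc n) τ) α + (- 1ℚ) * (hd 1 r ⊛ partialRM1 (suc a) n τ) α ∎
  where
  u v : ℕ → ℚ
  u i = sgn i * (P (a ℕ.+ i) ⊛ (hS r ⊛ E i τ)) α
  v i = sgn i * (P (suc a ℕ.+ i) ⊛ (hd 1 r ⊛ E i τ)) α

  arith : ∀ s x y → (- s) * (x + y) ≡ (- s) * x + (- 1ℚ) * (s * y)
  arith = solve 3 (λ s x y → (:- s) :* (x :+ y) := (:- s) :* x :+ con (- 1ℚ) :* (s :* y)) refl

  term : ∀ i → sgn (suc i) * (P (a ℕ.+ suc i) ⊛ E (suc i) (r ∷ τ)) α ≡ u (suc i) + (- 1ℚ) * v i
  term i = begin
    sgn (suc i) * (P (a ℕ.+ suc i) ⊛ E (suc i) (r ∷ τ)) α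
      ≡⟨ cong (sgn (suc i) *_) (⊛-linearʳ (P (a ℕ.+ suc i)) α .add (hS r ⊛ E (suc i) τ) (hd 1 r ⊛ E i τ)) ⟩
    (- sgn i) * ((P (a ℕ.+ suc i) ⊛ (hS r ⊛ E (suc i) τ)) α + (P (a ℕ.+ suc i) ⊛ (hd 1 r ⊛ E i τ)) α)
      ≡⟨ arith (sgn i) _ _ ⟩
    u (suc i) + (- 1ℚ) * (sgn i * (P (a ℕ.+ suc i) ⊛ (hd 1 r ⊛ E i τ)) α)
      ≡⟨ cong (λ m → u (suc i) + (- 1ℚ) * (sgn i * (P m ⊛ (hd 1 r ⊛ E i τ)) α)) (ℕP.+-suc a i) ⟩
    u (suc i) + (- 1ℚ) * v i ∎

-- Both sides obey the same recursion in τ. The degree condition survives raising a and lowering n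
-- by one, and at n = 0 it forces both sides to vanish.
partialRM1-C : ∀ a n τ α → size α < a ℕ.+ n → partialRM1 a n τ α ≡ C a (hProd τ) α
partialRM1-C a zero τ α p = sym (C-degree a (hProd τ) α (subst (size α <_) (ℕP.+-identityʳ a) p))
partialRM1-C a (suc n) [] α p = begin
  1ℚ * (P (a ℕ.+ 0) ⊛ hS 0) α + Σ< n (λ i → sgn (suc i) * (P (a ℕ.+ suc i) ⊛ 𝟘) α)
    ≡⟨ cong₂ _+_ (trans (ℚP.*-identityˡ _) (hS0-unitʳ (P (a ℕ.+ 0)) α))
         (Σ<-zero n _ λ i → trans (cong (sgn (suc i) *_) (zero-at (⊛-linearʳ (P (a ℕ.+ suc i)) α) λ _ → refl)) (ℚP.*-zeroʳ (sgn (suc i)))) ⟩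
  P (a ℕ.+ 0) α + 0ℚ
    ≡⟨ ℚP.+-identityʳ _ ⟩
  P (a ℕ.+ 0) α
    ≡⟨ cong (λ m → P m α) (ℕP.+-identityʳ a) ⟩
  P a α ∎
partialRM1-C a (suc n) (r ∷ τ) α p = begin
  partialRM1 a (suc n) (r ∷ τ) α
    ≡⟨ partialRM1-∷ a n r τ α ⟩
  (hS r ⊛ partialRM1 a (suc n) τ) α + (- 1ℚ) * (hd 1 r ⊛ partialRM1 (suc a) n τ) α
    ≡⟨ cong₂ (λ x y → x + (- 1ℚ) * y)
         (⊛-cong-≤ {hS r} α (λ _ _ → refl) λ β β≤ → partialRM1-C a (suc n) τ β (ℕP.≤-<-trans β≤ p))
         (⊛-cong-≤ {hd 1 r} α (λ _ _ → refl) λ β β≤ →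
           partialRM1-C (suc a) n τ β (ℕP.≤-<-trans β≤ (subst (size α <_) (ℕP.+-suc a n) p))) ⟩
  (hS r ⊛ C a (hProd τ)) α + (- 1ℚ) * (hd 1 r ⊛ C (suc a) (hProd τ)) α
    ≡⟨ cong (_+ (- 1ℚ) * (hd 1 r ⊛ C (suc a) (hProd τ)) α) (C-hd-⊛ a 0 r (hProd τ) α) ⟩
  (C a (hS r ⊛ hProd τ) α + (hd 1 r ⊛ C (suc a) (hProd τ)) α) + (- 1ℚ) * (hd 1 r ⊛ C (suc a) (hProd τ)) α
    ≡⟨ +-cancel _ _ ⟩
  C a (hS r ⊛ hProd τ) α
    ≡⟨ C-linear a α .ext (hProd-∷ r τ) ⟨
  C a (hProd (r ∷ τ)) α ∎

-- Extension of RM_a^{(1)} = C_a to the span by linearity.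

perp-linear : ∀ g α → Linear (λ f → perp g f α)
perp-linear g α = hall-linear (mulH g (normalize α))
  where
  hall-linear : ∀ g → Linear (λ f → hall f g)
  hall-linear [] .ext e = refl
  hall-linear ((c , μ) ∷ g) .ext e = cong₂ _+_ (cong (c *_) (e (normalize μ))) (hall-linear g .ext e)
  hall-linear [] .add S U = refl
  hall-linear ((c , μ) ∷ g) .add S U = trans
    (cong₂ _+_ (ℚP.*-distribˡ-+ c (S (normalize μ)) (U (normalize μ))) (hall-linear g .add S U))
    (+-middle (c * S (normalize μ)) _ _ _)
  hall-linear [] .scale d S = sym (ℚP.*-zeroʳ d)
  hall-linear ((c , μ) ∷ g) .scale d S = trans
    (cong₂ _+_ (*-swapˡ c d (S (normalize μ))) (hall-linear g .scale d S))
    (sym (ℚP.*-distribˡ-+ d (c * S (normalize μ)) _))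

module _ (eH : ℕ → HPoly) (eH-eS : ∀ i α → toSeries (eH i) α ≡ eS i α) (a : ℕ) where

  term : ℕ → Series → Series
  term i f α = sgn i * (mS (suc a ℕ.+ i ∷ []) ⊛ perp (eH i) f) α

  term-linear : ∀ i α → Linear (λ f → term i f α)
  term-linear i α = record
    { ext = λ e → cong (sgn i *_) (L .ext λ β → perp-linear (eH i) β .ext e)
    ; add = λ S U → trans (cong (sgn i *_) (trans (L .ext λ β → perp-linear (eH i) β .add S U)
        (L .add (perp (eH i) S) (perp (eH i) U)))) (ℚP.*-distribˡ-+ (sgn i) _ _)
    ; scale = λ c S → trans (cong (sgn i *_) (trans (L .ext λ β → perp-linear (eH i) β .scale c S)
        (L .scale c (perp (eH i) S)))) (*-swapˡ (sgn i) c _)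
    }
    where
    L = ⊛-linearʳ (mS (suc a ℕ.+ i ∷ [])) α

  RM1-Σ< : ∀ f α → RM1 eH (suc a) f α ≡ Σ< (suc (size α)) (λ i → term i f α)
  RM1-Σ< f α = trans (sumℚ-upTo (λ i → sgn i * (mS (suc a ℕ.+ i ∷ []) ⋆ perp (eH i) f) α) (suc (size α)))
    (Σ<-cong (suc (size α)) λ i _ → cong (sgn i *_) (⋆≗⊛ (mS (suc a ℕ.+ i ∷ [])) (perp (eH i) f) α))

  RM1-linear : ∀ α → Linear (λ f → RM1 eH (suc a) f α)
  RM1-linear α = record
    { ext = λ {S} {U} e → trans (RM1-Σ< S α) (trans (Σ<-cong n λ i _ → term-linear i α .ext e) (sym (RM1-Σ< U α)))
    ; add = λ S U → trans (RM1-Σ< (S ⊕ U) α) (trans (Σ<-cong n λ i _ → term-linear i α .add S U)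
        (trans (Σ<-+ n (λ i → term i S α) (λ i → term i U α)) (sym (cong₂ _+_ (RM1-Σ< S α) (RM1-Σ< U α)))))
    ; scale = λ c S → trans (RM1-Σ< (c ⊙ S) α) (trans (Σ<-cong n λ i _ → term-linear i α .scale c S)
        (trans (Σ<-* n c (λ i → term i S α)) (cong (c *_) (sym (RM1-Σ< S α)))))
    }
    where
    n = suc (size α)

  RM1-C : ∀ {f} → Span f → RM1 eH (suc a) f ≗ C (suc a) f
  RM1-C (hprod τ) α = begin
    RM1 eH (suc a) (hProd τ) α
      ≡⟨ RM1-Σ< (hProd τ) α ⟩
    Σ< (suc (size α)) (λ i → term i (hProd τ) α)
      ≡⟨ Σ<-cong (suc (size α)) (λ i _ → cong (sgn i *_)
           (⊛-cong (λ β → sym (P-mS (a ℕ.+ i) β)) (perp-hProd (eH i) i (eH-eS i) τ) α)) ⟩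
    partialRM1 (suc a) (suc (size α)) τ α
      ≡⟨ partialRM1-C (suc a) (suc (size α)) τ α (ℕP.m≤n+m (suc (size α)) (suc a)) ⟩
    C (suc a) (hProd τ) α ∎
  RM1-C (_⊕ˢ_ {S} {U} s u) α = trans (RM1-linear α .add S U)
    (trans (cong₂ _+_ (RM1-C s α) (RM1-C u α)) (sym (C-linear (suc a) α .add S U)))
  RM1-C (_⊙ˢ_ c {S} s) α = trans (RM1-linear α .scale c S)
    (trans (cong (c *_) (RM1-C s α)) (sym (C-linear (suc a) α .scale c S)))
  RM1-C (respˢ e s) α = trans (sym (RM1-linear α .ext e)) (trans (RM1-C s α) (C-linear (suc a) α .ext e))

  -- `RM1` and `C` are compared on the span, so every intermediate iterate must stay in it; `Span-C`
  -- ensures this.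
  iter-RM1 : ∀ k {f g} → Span f → g ≗ f → iter k (RM1 eH (suc a)) g ≗ iter k (C (suc a)) f
  iter-RM1 zero s e = e
  iter-RM1 (suc k) {f} {g} s e α = trans (RM1-linear α .ext (iter-RM1 k s e)) (RM1-C (span k) α)
    where
    span : ∀ k → Span (iter k (C (suc a)) f)
    span zero = s
    span (suc k) = Span-C a (span k)

-- The coefficients of RM_a m_λ

ι-* : ∀ m n → ι (m ℕ.* n) ≡ ι m * ι n
ι-* zero n = sym (ℚP.*-zeroˡ (ι n))
ι-* (suc m) n = begin
  ι (n ℕ.+ m ℕ.* n)       ≡⟨ ι-+ n (m ℕ.* n) ⟩
  ι n + ι (m ℕ.* n)       ≡⟨ cong (ι n +_) (ι-* m n) ⟩
  ι n + ι m * ι n         ≡⟨ arith (ι n) (ι m) ⟩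
  (1ℚ + ι m) * ι n        ∎
  where
  arith : ∀ n m → n + m * n ≡ (1ℚ + m) * n
  arith = solve 2 (λ n m → n :+ m :* n := (con 1ℚ :+ m) :* n) refl

toℚᵘ-ι : ∀ n → ℚ.toℚᵘ (ι n) ℚᵘ.≃ ℚᵘ.mkℚᵘ (ℤ.+ n) 0
toℚᵘ-ι zero = ℚᵘP.≃-refl
toℚᵘ-ι (suc n) = ℚᵘP.≃-trans (ℚP.toℚᵘ-homo-+ 1ℚ (ι n)) (ℚᵘP.≃-trans (ℚᵘP.+-congʳ ℚᵘ.1ℚᵘ (toℚᵘ-ι n))
  (ℚᵘ.*≡* (cong (λ z → (ℤ.+ 1 ℤ.+ z) ℤ.* ℤ.+ 1) (ℤP.*-identityʳ (ℤ.+ n)))))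

-- `_/_` reduces fractions to lowest terms, so the identity is checked on unnormalised
-- representatives.
ι-inverse : ∀ m .{{_ : ℕ.NonZero m}} → ι m * (ℤ.+ 1 / m) ≡ 1ℚ
ι-inverse (suc d) = ℚP.toℚᵘ-injective (ℚᵘP.≃-trans (ℚP.toℚᵘ-homo-* (ι (suc d)) (ℤ.+ 1 / suc d))
  (ℚᵘP.≃-trans (ℚᵘP.*-cong (toℚᵘ-ι (suc d)) (ℚP.toℚᵘ-fromℚᵘ (ℚᵘ.mkℚᵘ (ℤ.+ 1) d)))
    (ℚᵘ.*≡* (cong ℤ.+_ (trans (trans (ℕP.*-identityʳ _) (ℕP.*-identityʳ (suc d)))
      (sym (trans (ℕP.+-identityʳ _) (ℕP.+-identityʳ (suc d)))))))))

invFact-suc : ∀ n → invFact n ≡ ι (suc n) * invFact (suc n)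
invFact-suc n = begin
  x                             ≡⟨ ℚP.*-identityʳ x ⟨
  x * 1ℚ                        ≡⟨ cong (x *_) (ι-inverse (suc n !) {{suc n ℕP.!≢0}}) ⟨
  x * (ι (suc n !) * y)         ≡⟨ cong (λ z → x * (z * y)) (ι-* (suc n) (n !)) ⟩
  x * ((ι (suc n) * ι (n !)) * y) ≡⟨ arith x (ι (suc n)) (ι (n !)) y ⟩
  (ι (n !) * x) * (ι (suc n) * y) ≡⟨ cong (_* (ι (suc n) * y)) (ι-inverse (n !) {{n ℕP.!≢0}}) ⟩
  1ℚ * (ι (suc n) * y)          ≡⟨ ℚP.*-identityˡ _ ⟩
  ι (suc n) * y                 ∎
  where
  x = invFact n
  y = invFact (suc n)

  arith : ∀ x s f y → x * ((s * f) * y) ≡ (f * x) * (s * y)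
  arith = solve 4 (λ x s f y → x :* ((s :* f) :* y) := (f :* x) :* (s :* y)) refl

-- The falling factorial n(n-1)...(n-k+1). Where `ℕ.pred` truncates, the factor `ι 0` already makes
-- the product zero.
fall : ℕ → ℕ → ℚ
fall n zero = 1ℚ
fall n (suc k) = ι n * fall (ℕ.pred n) k

fall-zero : ∀ n k → n < k → fall n k ≡ 0ℚ
fall-zero zero (suc k) _ = ℚP.*-zeroˡ (fall 0 k)
fall-zero (suc n) (suc k) (s≤s p) = trans (cong (ι (suc n) *_) (fall-zero n k p)) (ℚP.*-zeroʳ (ι (suc n)))

-- `fall` is defined by peeling off the first factor; this peels off the last one, n - k, without
-- subtraction.
fall-step : ∀ n k → fall n (suc k) + ι k * fall n k ≡ ι n * fall n k
fall-step n zero = ℚP.+-identityʳ (ι n * 1ℚ)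
fall-step zero (suc k) = arith (fall 0 (suc k)) (ι (suc k)) (fall 0 k)
  where
  arith : ∀ f x g → 0ℚ * f + x * (0ℚ * g) ≡ 0ℚ * (0ℚ * g)
  arith = solve 3 (λ f x g → con 0ℚ :* f :+ x :* (con 0ℚ :* g) := con 0ℚ :* (con 0ℚ :* g)) refl
fall-step (suc n) (suc k) = begin
  ι (suc n) * fall n (suc k) + (1ℚ + ι k) * (ι (suc n) * fall n k)
    ≡⟨ arith₁ (ι (suc n)) (fall n (suc k)) (ι k) (fall n k) ⟩
  ι (suc n) * ((fall n (suc k) + ι k * fall n k) + fall n k)
    ≡⟨ cong (λ z → ι (suc n) * (z + fall n k)) (fall-step n k) ⟩
  ι (suc n) * (ι n * fall n k + fall n k)
    ≡⟨ cong (ι (suc n) *_) (arith₂ (ι n) (fall n k)) ⟩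
  ι (suc n) * (ι (suc n) * fall n k) ∎
  where
  arith₁ : ∀ s g k f → s * g + (1ℚ + k) * (s * f) ≡ s * ((g + k * f) + f)
  arith₁ = solve 4 (λ s g k f → s :* g :+ (con 1ℚ :+ k) :* (s :* f) := s :* ((g :+ k :* f) :+ f)) refl

  arith₂ : ∀ n f → n * f + f ≡ (1ℚ + n) * f
  arith₂ = solve 2 (λ n f → n :* f :+ f := (con 1ℚ :+ n) :* f) refl

-- By Pascal's rule (-1)^k C(m + 1, k + 1) = r_k − r_{k+1} with r_k = (-1)^k C(m, k); here C(m, k) is written as
-- fall m k / k!.
alternating-sum : ∀ m N →
  Σ< N (λ k → sgn k * invFact (suc k) * fall (suc m) (suc k)) + sgn N * invFact N * fall m N ≡ 1ℚ
alternating-sum m zero = refl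
alternating-sum m (suc N) = begin
  Σ< (suc N) t + r (suc N)
    ≡⟨ cong (_+ r (suc N)) (Σ<-last N t) ⟩
  (Σ< N t + t N) + r (suc N)
    ≡⟨ ℚP.+-assoc (Σ< N t) (t N) (r (suc N)) ⟩
  Σ< N t + (t N + r (suc N))
    ≡⟨ cong (Σ< N t +_) telescope ⟩
  Σ< N t + r N
    ≡⟨ alternating-sum m N ⟩
  1ℚ ∎
  where
  t r : ℕ → ℚ
  t k = sgn k * invFact (suc k) * fall (suc m) (suc k)
  r k = sgn k * invFact k * fall m k

  arith₁ : ∀ s i f g n → s * i * ((1ℚ + n) * f) + (- s) * i * g ≡ s * i * ((n * f + f) + (- 1ℚ) * g)
  arith₁ = solve 5 (λ s i f g n → s :* i :* ((con 1ℚ :+ n) :* f) :+ (:- s) :* i :* g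
    := s :* i :* ((n :* f :+ f) :+ con (- 1ℚ) :* g)) refl

  arith₂ : ∀ s i f g k → s * i * (((g + k * f) + f) + (- 1ℚ) * g) ≡ s * ((1ℚ + k) * i) * f
  arith₂ = solve 5 (λ s i f g k → s :* i :* (((g :+ k :* f) :+ f) :+ con (- 1ℚ) :* g)
    := s :* ((con 1ℚ :+ k) :* i) :* f) refl

  i = invFact (suc N)

  telescope : t N + r (suc N) ≡ r N
  telescope = begin
    t N + r (suc N)
      ≡⟨ arith₁ (sgn N) i (fall m N) (fall m (suc N)) (ι m) ⟩
    sgn N * i * ((ι m * fall m N + fall m N) + (- 1ℚ) * fall m (suc N))
      ≡⟨ cong (λ z → sgn N * i * ((z + fall m N) + (- 1ℚ) * fall m (suc N))) (fall-step m N) ⟨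
    sgn N * i * (((fall m (suc N) + ι N * fall m N) + fall m N) + (- 1ℚ) * fall m (suc N))
      ≡⟨ arith₂ (sgn N) i (fall m N) (fall m (suc N)) (ι N) ⟩
    sgn N * (ι (suc N) * i) * fall m N
      ≡⟨ cong (λ z → sgn N * z * fall m N) (invFact-suc N) ⟨
    r N ∎

-- Monomial series lie in the span.

Span-mS : ∀ {μ} → IsPartition μ → Span (mS μ)
-- The factor in `C-mS` is a positive integer, hence can be divided out over ℚ.
Span-mS-insertDesc : ∀ {x μ} → 0 < x → IsPartition μ → Span (mS (insertDesc x μ))

Span-mS nil = respˢ (sym ∘ mS-[]) (hprod [])
Span-mS (one 0<x) = Span-mS-insertDesc 0<x nil
-- The first part is the largest, so inserting it merely prepends it.
Span-mS p@(cons {ys = ys} y≤x q) = subst (Span ∘ mS) (insertDesc-≤ ys y≤x)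
  (Span-mS-insertDesc (partition-head-positive p) q)

Span-mS-insertDesc {suc a} {μ} _ p = respˢ (λ α → begin
    (ℤ.+ 1 / suc c) * C (suc a) (mS μ) α    ≡⟨ cong ((ℤ.+ 1 / suc c) *_) (C-mS a μ α) ⟩
    (ℤ.+ 1 / suc c) * (ι (suc c) * m α)     ≡⟨ ℚP.*-assoc (ℤ.+ 1 / suc c) (ι (suc c)) (m α) ⟨
    (ℤ.+ 1 / suc c) * ι (suc c) * m α       ≡⟨ cong (_* m α) (trans (ℚP.*-comm (ℤ.+ 1 / suc c) (ι (suc c))) (ι-inverse (suc c))) ⟩
    1ℚ * m α                                ≡⟨ ℚP.*-identityˡ (m α) ⟩
    m α                                     ∎)
  ((ℤ.+ 1 / suc c) ⊙ˢ Span-C a (Span-mS p))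
  where
  c = count (suc a) μ
  m = mS (insertDesc (suc a) μ)

Span-replicate : ∀ {S} a k → Span S → Span (λ α → S (replicate k a ++ α))
Span-replicate a zero s = s
Span-replicate a (suc k) s = Span-replicate a k (Span-∷ a s)

-- C_a on the series (h_a^k)^⊥ m_μ.

module _ (a : ℕ) (μ : List ℕ) where

  -- mPower (k + 1) is (h_a^k)^⊥ m_μ, and mPower 0 is what (h_a^{-1})^⊥ m_μ should be.
  mPower : ℕ → Series
  mPower zero = mS (insertDesc (suc a) μ)
  mPower (suc k) α = mS μ (replicate k (suc a) ++ α)

  -- `C` puts back one part `suc a`. On the support of `mPower k` an exponent vector has
  -- `suc (count (suc a) μ) ∸ k` entries `suc a`, any of which can be the one put back.
  C-mPower : ∀ k → C (suc a) (mPower (suc k)) ≗ ι (suc (count (suc a) μ) ∸ k) ⊙ mPower k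
  C-mPower zero = C-mS a μ
  C-mPower (suc k) α = trans (C-replace (suc a) (mPower (suc (suc k))) (mPower (suc k)) replace α)
    (mS-weight {μ} {replicate k (suc a) ++ α} (ι (count (suc a) α)) (ι (count (suc a) μ ∸ k)) λ e → cong ι (begin
      count (suc a) α
        ≡⟨ ℕP.m+n∸m≡n k _ ⟨
      k ℕ.+ count (suc a) α ∸ k
        ≡⟨ cong (_∸ k) (count-replicate (suc a) k α) ⟨
      count (suc a) (replicate k (suc a) ++ α) ∸ k
        ≡⟨ cong (_∸ k) (count-normalize a (replicate k (suc a) ++ α)) ⟨
      count (suc a) (normalize (replicate k (suc a) ++ α)) ∸ k
        ≡⟨ cong (λ ν → count (suc a) ν ∸ k) e ⟩
      count (suc a) μ ∸ k ∎))
    where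
    replace : ∀ β γ → mPower (suc (suc k)) (β ++ 0 ∷ γ) ≡ mPower (suc k) (β ++ suc a ∷ γ)
    replace β γ = cong (λ ν → ind (ν == μ)) (begin
      insertDesc (suc a) (normalize (ρ ++ β ++ 0 ∷ γ))   ≡⟨ cong (insertDesc (suc a) ∘ normalize) (LP.++-assoc ρ β (0 ∷ γ)) ⟨
      insertDesc (suc a) (normalize ((ρ ++ β) ++ 0 ∷ γ)) ≡⟨ cong (insertDesc (suc a)) (normalize-drop (ρ ++ β) γ) ⟩
      insertDesc (suc a) (normalize ((ρ ++ β) ++ γ))     ≡⟨ normalize-pull (ρ ++ β) a γ ⟨
      normalize ((ρ ++ β) ++ suc a ∷ γ)                  ≡⟨ cong normalize (LP.++-assoc ρ β (suc a ∷ γ)) ⟩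
      normalize (ρ ++ β ++ suc a ∷ γ)                    ∎)
      where
      ρ = replicate k (suc a)

  -- The factors from `C-mPower` drop by one as the index grows, so their product is a falling
  -- factorial.
  iter-C-mPower : ∀ k m → iter k (C (suc a)) (mPower (k ℕ.+ m)) ≗ fall (suc (count (suc a) μ) ∸ m) k ⊙ mPower m
  iter-C-mPower zero m α = sym (ℚP.*-identityˡ (mPower m α))
  iter-C-mPower (suc k) m α = begin
    C (suc a) (iter k (C (suc a)) (mPower (suc k ℕ.+ m))) α
      ≡⟨ cong (λ j → C (suc a) (iter k (C (suc a)) (mPower j)) α) (ℕP.+-suc k m) ⟨
    C (suc a) (iter k (C (suc a)) (mPower (k ℕ.+ suc m))) α
      ≡⟨ C-linear (suc a) α .ext (iter-C-mPower k (suc m)) ⟩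
    C (suc a) (f ⊙ mPower (suc m)) α
      ≡⟨ C-linear (suc a) α .scale f (mPower (suc m)) ⟩
    f * C (suc a) (mPower (suc m)) α
      ≡⟨ cong (f *_) (C-mPower m α) ⟩
    f * (ι n * mPower m α)
      ≡⟨ *-swapˡ f (ι n) (mPower m α) ⟩
    ι n * (f * mPower m α)
      ≡⟨ ℚP.*-assoc (ι n) f (mPower m α) ⟨
    ι n * f * mPower m α
      ≡⟨ cong (λ j → ι n * fall j k * mPower m α) (ℕP.pred[m∸n]≡m∸[1+n] (suc (count (suc a) μ)) m) ⟨
    fall n (suc k) * mPower m α ∎
    where
    n = suc (count (suc a) μ) ∸ m
    f = fall (suc (count (suc a) μ) ∸ suc m) k

  -- `perp` normalizes α and then the extended vector; symmetry of span members removes both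
  -- normalizations.
  perp-mS : IsPartition μ → ∀ k → perp ((1ℚ , replicate k (suc a)) ∷ []) (mS μ) ≗ mPower (suc k)
  perp-mS p k α = begin
    1ℚ * mS μ (normalize (replicate k (suc a) ++ normalize α)) + 0ℚ
      ≡⟨ trans (ℚP.+-identityʳ _) (ℚP.*-identityˡ _) ⟩
    mS μ (normalize (replicate k (suc a) ++ normalize α))
      ≡⟨ Span-normalize (Span-mS p) (replicate k (suc a) ++ normalize α) ⟩
    mPower (suc k) (normalize α)
      ≡⟨ Span-normalize (Span-replicate (suc a) k (Span-mS p)) α ⟩
    mPower (suc k) α ∎

mainTheorem8 : (eH : ℕ → HPoly) → (∀ i α → toSeries (eH i) α ≡ eS i α) →
    (a : ℕ) → 0 < a → (λ' : List ℕ) → IsPartition λ' →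
    ∀ α → RM eH a (mS λ') α ≡ mS (addPart a λ') α
mainTheorem8 eH eH-eS (suc a) _ μ p α = begin
  RM eH (suc a) (mS μ) α
    ≡⟨ sumℚ-upTo (λ k → sgn k * invFact (suc k) *
         iter (suc k) (RM1 eH (suc a)) (perp ((1ℚ , replicate k (suc a)) ∷ []) (mS μ)) α) N ⟩
  Σ< N (λ k → sgn k * invFact (suc k) *
    iter (suc k) (RM1 eH (suc a)) (perp ((1ℚ , replicate k (suc a)) ∷ []) (mS μ)) α)
    ≡⟨ Σ<-cong N (λ k _ → term-value k) ⟩
  Σ< N (λ k → M * t k)
    ≡⟨ Σ<-* N M t ⟩
  M * Σ< N t
    ≡⟨ ℚP.*-comm M (Σ< N t) ⟩
  Σ< N t * M
    -- The sum has to be 1 only where `M` is nonzero; there α has c + 1 entries `suc a`, so the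
    -- truncation `N` exceeds c.
    ≡⟨ mS-weight {insertDesc (suc a) μ} {α} (Σ< N t) 1ℚ total ⟩
  1ℚ * M
    ≡⟨ ℚP.*-identityˡ M ⟩
  M
    ≡⟨ cong (λ ν → mS (insertDesc (suc a) ν) α) (normalize-partition p) ⟨
  mS (addPart (suc a) μ) α ∎
  where
  N = suc (size α)
  c = count (suc a) μ
  M = mS (insertDesc (suc a) μ) α

  t : ℕ → ℚ
  t k = sgn k * invFact (suc k) * fall (suc c) (suc k)

  term-value : ∀ k → sgn k * invFact (suc k) *
    iter (suc k) (RM1 eH (suc a)) (perp ((1ℚ , replicate k (suc a)) ∷ []) (mS μ)) α ≡ M * t k
  term-value k = begin
    w * iter (suc k) (RM1 eH (suc a)) (perp ((1ℚ , replicate k (suc a)) ∷ []) (mS μ)) α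
      ≡⟨ cong (w *_) (iter-RM1 eH eH-eS a (suc k) (Span-replicate (suc a) k (Span-mS p)) (perp-mS a μ p k) α) ⟩
    w * iter (suc k) (C (suc a)) (mPower a μ (suc k)) α
      -- The k + 1 applications of `C` lead from `mPower (suc k)` down to `mPower 0`, which is
      -- m_{λ+(a)}.
      ≡⟨ cong (λ j → w * iter (suc k) (C (suc a)) (mPower a μ j) α) (ℕP.+-identityʳ (suc k)) ⟨
    w * iter (suc k) (C (suc a)) (mPower a μ (suc k ℕ.+ 0)) α
      ≡⟨ cong (w *_) (iter-C-mPower a μ (suc k) 0 α) ⟩
    w * (fall (suc c) (suc k) * M)
      ≡⟨ ℚP.*-assoc w (fall (suc c) (suc k)) M ⟨
    t k * M
      ≡⟨ ℚP.*-comm (t k) M ⟩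
    M * t k ∎
    where
    w = sgn k * invFact (suc k)

  total : normalize α ≡ insertDesc (suc a) μ → Σ< N t ≡ 1ℚ
  total e = begin
    Σ< N t
      ≡⟨ ℚP.+-identityʳ _ ⟨
    Σ< N t + 0ℚ
      -- The remainder in `alternating-sum` is a multiple of the falling factorial `fall c N`, which
      -- vanishes as c < N.
      ≡⟨ cong (Σ< N t +_) (trans (cong (sgn N * invFact N *_) (fall-zero c N c<N)) (ℚP.*-zeroʳ (sgn N * invFact N))) ⟨
    Σ< N t + sgn N * invFact N * fall c N
      ≡⟨ alternating-sum c N ⟩
    1ℚ ∎
    where
    count-α : count (suc a) α ≡ suc c
    count-α = begin
      count (suc a) α                      ≡⟨ count-normalize a α ⟨
      count (suc a) (normalize α)          ≡⟨ cong (count (suc a)) e ⟩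
      count (suc a) (insertDesc (suc a) μ) ≡⟨ count-insertDesc (suc a) (suc a) μ ⟩
      count (suc a) (suc a ∷ μ)            ≡⟨ count-≡ (suc a) μ ⟩
      suc c                                ∎

    c<N : c < N
    c<N = ℕP.m≤n⇒m≤1+n (subst (_≤ size α) count-α (count-≤-size a α))
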